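{- Let $1\leq c\leq d$ be integers, let $i,j\in\{0,1,2,3,4\}$ with $c\equiv i$, $d\equiv j\pmod 5$, and let $a$ be a value in the set $A_{\{i,j\}}$ given by the following table (indexed by the unordered pair $\{i,j\}$): $\{0,0\}:\{1,2,3,4\}$; $\{0,1\}:\{2,3,4\}$; $\{0,2\}:\{1,3,4\}$; $\{0,3\}:\{1,2,4\}$; $\{0,4\}:\{1,2,3\}$; $\{1,1\}:\{3,4\}$; $\{1,2\}:\{4\}$; $\{1,3\}:\{2\}$; $\{1,4\}:\{2,3\}$; $\{2,2\}:\{1,3\}$; $\{2,3\}:\{1,4\}$; $\{2,4\}:\{3\}$; $\{3,3\}:\{2,4\}$; $\{3,4\}:\{1\}$; $\{4,4\}:\{1,2\}$. Then for all $n\geq 0$ and all $0\leq k\leq 4$, \[ N_{[c,d]}(k,5,5n+a)=\frac{p_{[c^2d^2]}(5n+a)}{5}. \] In particular, $p_{[c^2d^2]}(5n+a)\equiv 0\pmod 5$.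
   Context: A $4$-colored partition of type $(c,d)$ of $n$ is a quadruple $(\pi_r,\pi_b,\pi_y,\pi_o)$ of integer partitions with total sum of parts $n$, such that all parts of $\pi_r$ and $\pi_b$ are divisible by $c$ and all parts of $\pi_y$ and $\pi_o$ are divisible by $d$. Their number is $p_{[c^2d^2]}(n)$, i.e. $\sum_{n\ge0}p_{[c^2d^2]}(n)q^n=\frac{1}{(q^c;q^c)_\infty^2(q^d;q^d)_\infty^2}$, where $(a;q)_\infty=\prod_{k\ge0}(1-aq^k)$. With $\ell(\pi)$ the number of parts, the $4$-colored rank is $r_4=\ell(\pi_r)-\ell(\pi_b)+\ell(\pi_y)-\ell(\pi_o)$. $N_{[c,d]}(k,5,m)$ is the number of $4$-colored partitions of $m$ of type $(c,d)$ with $r_4\equiv k\pmod 5$. -}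

module Defs where

open import Data.Nat using (ℕ; zero; suc; _+_; _*_; _≤_; _⊓_; _⊔_; _≟_)
open import Data.Nat.Divisibility using (_∣_; _∣?_)
open import Data.Integer as ℤ using (ℤ; +_; _%ℕ_)
open import Data.List using (List; []; _∷_; map; concatMap; filter; length; upTo; applyUpTo)
open import Data.Nat.ListAction using (sum)
open import Data.List.Relation.Unary.All using (All; all?)
open import Data.Product using (_×_; _,_)
open import Relation.Binary.PropositionalEquality using (_≡_)

-- An integer partition is a nonincreasing list of positive parts.
-- decrLists l m : all nonincreasing lists of length l with every entry in {1,…,m}.
decrLists : ℕ → ℕ → List (List ℕ)
decrLists zero    m = [] ∷ []
decrLists (suc l) m =
  concatMap (λ p → map (p ∷_) (decrLists l p)) (applyUpTo suc m)

-- All integer partitions of n (each has at most n parts, each part ≤ n).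
partitions : ℕ → List (List ℕ)
partitions n =
  filter (λ xs → sum xs ≟ n) (concatMap (λ l → decrLists l n) (upTo (suc n)))

partitionsDiv : ℕ → ℕ → List (List ℕ)
partitionsDiv c n = filter (λ xs → all? (c ∣?_) xs) (partitions n)

partitionsDivUpTo : ℕ → ℕ → List (List ℕ)
partitionsDivUpTo c m = concatMap (partitionsDiv c) (upTo (suc m))

-- 4-colored partitions (π_r, π_b, π_y, π_o).
Quad : Set
Quad = List ℕ × List ℕ × List ℕ × List ℕ

size : Quad → ℕ
size (r , b , y , o) = sum r + sum b + sum y + sum o

colored4 : ℕ → ℕ → ℕ → List Quad
colored4 c d m =
  filter (λ q → size q ≟ m)
    (concatMap (λ r → concatMap (λ b → concatMap (λ y → map (λ o → r , b , y , o)
        (partitionsDivUpTo d m)) (partitionsDivUpTo d m)) (partitionsDivUpTo c m))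
      (partitionsDivUpTo c m))

p[c²d²] : ℕ → ℕ → ℕ → ℕ
p[c²d²] c d m = length (colored4 c d m)

rank4 : Quad → ℤ
rank4 (r , b , y , o) =
  ((+ length r) ℤ.- (+ length b)) ℤ.+ ((+ length y) ℤ.- (+ length o))

N[_,_] : ℕ → ℕ → ℕ → ℕ → ℕ
N[ c , d ] k m = length (filter (λ q → (rank4 q %ℕ 5) ≟ (k Data.Nat.% 5)) (colored4 c d m))

Atable : ℕ → ℕ → List ℕ
Atable 0 0 = 1 ∷ 2 ∷ 3 ∷ 4 ∷ []
Atable 0 1 = 2 ∷ 3 ∷ 4 ∷ []
Atable 0 2 = 1 ∷ 3 ∷ 4 ∷ []
Atable 0 3 = 1 ∷ 2 ∷ 4 ∷ []
Atable 0 4 = 1 ∷ 2 ∷ 3 ∷ []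
Atable 1 1 = 3 ∷ 4 ∷ []
Atable 1 2 = 4 ∷ []
Atable 1 3 = 2 ∷ []
Atable 1 4 = 2 ∷ 3 ∷ []
Atable 2 2 = 1 ∷ 3 ∷ []
Atable 2 3 = 1 ∷ 4 ∷ []
Atable 2 4 = 3 ∷ []
Atable 3 3 = 2 ∷ 4 ∷ []
Atable 3 4 = 1 ∷ []
Atable 4 4 = 1 ∷ 2 ∷ []
Atable _ _ = []

A : ℕ → ℕ → List ℕ
A i j = Atable (i ⊓ j) (i ⊔ j)

{-# OPTIONS --safe #-}
module Submission where

-- Over ℤ[ζ], ζ a primitive fifth root of unity, the generating function of ζ ^ r₄ is
-- P(q ^ c) P(q ^ d) with P(q) = 1 / ((ζ q; q)∞ (ζ⁻¹ q; q)∞) = G(q) / (q⁵; q⁵)∞,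
-- where G(q) = (q; q)∞ (ζ² q; q)∞ (ζ⁻² q; q)∞.  By the Jacobi triple product (1 − ζ²) G(q) is a
-- theta series ∑ ± ζ ^ (2 j) q ^ (j (j + 1) / 2) over j ∈ ℤ, up to a unit.  The terms j and −1 − j cancel
-- if 2 j + 1 ≡ 0 (mod 5), and otherwise j (j + 1) / 2 ≡ 0 or 1 (mod 5).  So only exponents congruent to
-- 0, c, d or c + d occur, and A lists the residues avoiding these.  Where the coefficient ∑ₖ N(k) ζ ^ k
-- vanishes, all N(k) are equal.
--
-- Everything is done modulo q ^ (m + 1), where m is the exponent in question: q is then nilpotent and
-- all series and products are finite.  The triple product comes from its finite form with Gaussian
-- binomial coefficients.

open import Defs
open import Algebra.Bundles using (CommutativeRing)
import Algebra.Properties.CommutativeSemiring.Exp as Exp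
import Algebra.Properties.Ring as RingProperties
import Algebra.Solver.Ring.NaturalCoefficients.Default as Solver
open import Algebra.Structures using (IsCommutativeRing)
open import Data.Bool using (Bool; true; false; if_then_else_)
open import Data.Fin using (Fin; toℕ; fromℕ<)
open import Data.Fin.Patterns
import Data.Fin.Properties as Fin
open import Data.Integer as ℤ using (ℤ; +_; -[1+_]; _%ℕ_)
import Data.Integer.DivMod as ℤ
import Data.Integer.Properties as ℤ
import Data.Integer.Tactic.RingSolver as ℤSolver
open import Data.List using (List; []; _∷_; _++_; _∷ʳ_; map; concatMap; filter; length; upTo; applyUpTo)
open import Data.List.Membership.Propositional using (_∈_)
import Data.List.Properties as List
open import Data.List.Relation.Unary.All as All using (All; all?)
open import Data.Nat as ℕ using (ℕ; zero; suc; s≤s; z≤n; _≤_; _%_)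
open import Data.Nat.DivMod using (m%n<n; [m+kn]%n≡m%n; m*n%n≡0; %-distribˡ-+; %-distribˡ-*)
open import Data.Nat.Divisibility using (_∣_; _∣?_; divides; ∣m+n∣m⇒∣n; ∣⇒≤)
open import Data.Nat.Induction using (<-rec)
open import Data.Nat.ListAction using (sum)
import Data.Nat.Properties as ℕ
open import Data.Nat.Solver using (module +-*-Solver)
open import Data.Product using (_×_; _,_; ∃-syntax)
open import Data.Sum using (_⊎_; inj₁; inj₂; [_,_]′)
open import Level using (0ℓ)
open import Relation.Binary.Definitions using (tri<; tri≈; tri>)
open import Relation.Binary.PropositionalEquality as ≡ using (_≡_; _≢_)
import Relation.Binary.Reasoning.Setoid as SetoidReasoning
open import Relation.Nullary using (yes; no; does; ¬_; ¬?; contradiction)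
open import Relation.Nullary.Decidable using (dec-true; dec-false; from-yes)
open import Relation.Unary using (Decidable; Pred)

-- The obstacle is cancellation. The identity reached is that the product of the theta series for
-- `c` and `d` equals two multipliers times the rank series, and the multipliers have to be removed
-- without division. This is done at the level of the predicate `Balanced`, which concerns all
-- exponents up to `m` in the residue class of `m` modulo 5. A factor `1 - q ^ (5 e)` mixes only
-- exponents of one class and is stripped by induction on the exponent. The factor `1 - ζ²` is no
-- unit, but it divides 5, and integer coefficients have no torsion. The choice `u = -ζ²` puts all
-- signs into powers of `u`: up to a common power of `u`, the theta terms are
-- `u ^ j q ^ (j (j + 1) / 2)`. Since `u ^ 5 = -1` and `2 j + 1` is odd, the terms `j` and `-1 - j`
-- cancel exactly when 5 divides `2 j + 1`. Instead of choosing one index from each pair, each theta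
-- series is added to its reversal; the resulting factor 4 is cancelled at the end.

-- Triangular numbers of integers, and their residues modulo 5.

-- T i B is the triangular number j (j + 1) / 2 of the integer j = i − B.
T : ℕ → ℕ → ℕ
T zero    zero    = 0
T (suc i) zero    = suc i ℕ.+ T i zero
T zero    (suc B) = B ℕ.+ T zero B
T (suc i) (suc B) = T i B

T-step : ∀ i B → T (suc i) B ℕ.+ B ≡ T i B ℕ.+ suc i
T-step i       zero    = ≡.trans (ℕ.+-identityʳ _) (ℕ.+-comm (suc i) (T i zero))
T-step zero    (suc B) = +-*-Solver.solve 2 (λ t b → t :+ (con 1 :+ b) := (b :+ t) :+ con 1) ≡.refl (T zero B) B
  where open +-*-Solver
T-step (suc i) (suc B) = ≡.trans (ℕ.+-suc _ B) (≡.trans (≡.cong suc (T-step i B)) (≡.sym (ℕ.+-suc _ (suc i))))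

-- If `a + b = A + B`, then `a + 1 - B = A + 1 - b`, so the step of `T` can also be read from the
-- other end of the row. Adding a factor on the `A` side of the finite triple product needs this
-- form.
T-step′ : ∀ {A B} a b → a ℕ.+ b ≡ A ℕ.+ B → T a B ℕ.+ suc A ≡ T (suc a) B ℕ.+ b
T-step′ {A} {B} a b eq = ℕ.+-cancelʳ-≡ B _ _ (begin
  T a B ℕ.+ suc A ℕ.+ B       ≡⟨ ℕ.+-assoc (T a B) (suc A) B ⟩
  T a B ℕ.+ suc (A ℕ.+ B)     ≡⟨ ≡.cong (λ s → T a B ℕ.+ suc s) eq ⟨
  T a B ℕ.+ (suc a ℕ.+ b)     ≡⟨ ℕ.+-assoc (T a B) (suc a) b ⟨
  T a B ℕ.+ suc a ℕ.+ b       ≡⟨ ≡.cong (ℕ._+ b) (T-step a B) ⟨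
  T (suc a) B ℕ.+ B ℕ.+ b     ≡⟨ ℕ.+-assoc (T (suc a) B) B b ⟩
  T (suc a) B ℕ.+ (B ℕ.+ b)   ≡⟨ ≡.cong (T (suc a) B ℕ.+_) (ℕ.+-comm B b) ⟩
  T (suc a) B ℕ.+ (b ℕ.+ B)   ≡⟨ ℕ.+-assoc (T (suc a) B) b B ⟨
  T (suc a) B ℕ.+ b ℕ.+ B     ∎)
  where open ≡.≡-Reasoning

T-right : ∀ B t → T (B ℕ.+ t) B ≡ T t 0
T-right zero    t = ≡.refl
T-right (suc B) t = T-right B t

-- The symmetry of `j (j + 1) / 2` under `j ↦ -1 - j`, at `j = -1 - t`.
T-left : ∀ i t → T i (i ℕ.+ suc t) ≡ T t 0
T-left (suc i) t       = T-left i t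
T-left zero    zero    = ≡.refl
T-left zero    (suc t) = ≡.cong (suc t ℕ.+_) (T-left zero t)

m≤T[m] : ∀ t → t ℕ.≤ T t 0
m≤T[m] zero    = z≤n
m≤T[m] (suc t) = ℕ.m≤m+n (suc t) _

-- The difference between the values at `t + 5` and `t` is `5 (t + 3)`, so five values decide. The
-- exceptional class of 2 is the one where 5 divides `2 t + 1`.
T-mod5 : ∀ t → (T t 0 ℕ.% 5 ℕ.≤ 1) ⊎ ∃[ s ] (t ≡ 2 ℕ.+ 5 ℕ.* s)
T-mod5 0 = inj₁ z≤n
T-mod5 1 = inj₁ (s≤s z≤n)
T-mod5 2 = inj₂ (0 , ≡.refl)
T-mod5 3 = inj₁ (s≤s z≤n)
T-mod5 4 = inj₁ z≤n
T-mod5 (suc (suc (suc (suc (suc t))))) with T-mod5 t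
... | inj₁ small = inj₁ (≡.subst (ℕ._≤ 1) (≡.sym T[5+t]%5) small)
  where
  T[5+t] : T (5 ℕ.+ t) 0 ≡ T t 0 ℕ.+ (3 ℕ.+ t) ℕ.* 5
  T[5+t] = solve 2 (λ t x → (con 5 :+ t) :+ ((con 4 :+ t) :+ ((con 3 :+ t) :+ ((con 2 :+ t) :+ ((con 1 :+ t) :+ x))))
                          := x :+ (con 3 :+ t) :* con 5) ≡.refl t (T t 0)
    where open +-*-Solver
  T[5+t]%5 : T (5 ℕ.+ t) 0 ℕ.% 5 ≡ T t 0 ℕ.% 5
  T[5+t]%5 = ≡.trans (≡.cong (ℕ._% 5) T[5+t]) ([m+kn]%n≡m%n (T t 0) (3 ℕ.+ t) 5)
... | inj₂ (s , eq)  = inj₂ (suc s , ≡.trans (≡.cong (5 ℕ.+_) eq)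
      (solve 1 (λ s → con 5 :+ (con 2 :+ con 5 :* s) := con 2 :+ con 5 :* (con 1 :+ s)) ≡.refl s))
  where open +-*-Solver

T-middle : ∀ {A} a t → a ℕ.+ t ≡ A → T a (suc A) ≡ T t 0
T-middle a t ≡.refl = ≡.trans (≡.cong (T a) (≡.sym (ℕ.+-suc a t))) (T-left a t)

-- The rows a + b = 2 A + 1, cut at the middle.
data Row (A : ℕ) : ℕ → ℕ → Set where
  right : ∀ t b → b ℕ.+ t ≡ A → Row A (suc A ℕ.+ t) b
  left  : ∀ t a → a ℕ.+ t ≡ A → Row A a (suc A ℕ.+ t)

row : ∀ A a b → a ℕ.+ b ≡ A ℕ.+ suc A → Row A a b
row A a b eq with suc A ℕ.≤? a
... | yes A<a = ≡.subst (λ a → Row A a b) (ℕ.m+[n∸m]≡n A<a)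
  (right t b (ℕ.+-cancelˡ-≡ (suc A) _ _ (begin
    suc A ℕ.+ (b ℕ.+ t)   ≡⟨ solve 3 (λ A b t → A :+ (b :+ t) := A :+ t :+ b) ≡.refl (suc A) b t ⟩
    suc A ℕ.+ t ℕ.+ b     ≡⟨ ≡.cong (ℕ._+ b) (ℕ.m+[n∸m]≡n A<a) ⟩
    a ℕ.+ b               ≡⟨ eq ⟩
    A ℕ.+ suc A           ≡⟨ ℕ.+-suc A A ⟩
    suc A ℕ.+ A           ∎)))
  where
  open ≡.≡-Reasoning
  open +-*-Solver
  t = a ℕ.∸ suc A
... | no A≮a = ≡.subst (Row A a) b≡ (left (A ℕ.∸ a) a a+t≡A)
  where
  open ≡.≡-Reasoning
  a+t≡A : a ℕ.+ (A ℕ.∸ a) ≡ A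
  a+t≡A = ℕ.m+[n∸m]≡n (ℕ.≮⇒≥ A≮a)
  b≡ : suc A ℕ.+ (A ℕ.∸ a) ≡ b
  b≡ = ℕ.+-cancelˡ-≡ a _ _ (begin
    a ℕ.+ (suc A ℕ.+ (A ℕ.∸ a))   ≡⟨ solve 3 (λ a A t → a :+ (A :+ t) := a :+ t :+ A) ≡.refl a (suc A) (A ℕ.∸ a) ⟩
    a ℕ.+ (A ℕ.∸ a) ℕ.+ suc A     ≡⟨ ≡.cong (ℕ._+ suc A) a+t≡A ⟩
    A ℕ.+ suc A                   ≡⟨ eq ⟨
    a ℕ.+ b                       ∎)
    where open +-*-Solver

T-symmetric : ∀ {A a b} → Row A a b → T a (suc A) ≡ T b (suc A)
T-symmetric {A} (right t b eq) = ≡.trans (T-right (suc A) t) (≡.sym (T-middle b t eq))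
T-symmetric {A} (left t a eq)  = ≡.trans (T-middle a t eq) (≡.sym (T-right (suc A) t))

-- The two indices of a row differ by `2 t + 1`; for `t = 2 + 5 s` this is `5 (2 s + 1)`, an odd
-- multiple of 5.
row-gap : ∀ b s → let t = 2 ℕ.+ 5 ℕ.* s in suc (b ℕ.+ t) ℕ.+ t ≡ 5 ℕ.* suc (2 ℕ.* s) ℕ.+ b
row-gap = solve 2 (λ b s → (con 1 :+ (b :+ (con 2 :+ con 5 :* s))) :+ (con 2 :+ con 5 :* s)
                         := con 5 :* (con 1 :+ con 2 :* s) :+ b) ≡.refl
  where open +-*-Solver

-- The Jacobi triple product, in finite form and for nilpotent `q`.

module TripleProduct {c ℓ} (R : CommutativeRing c ℓ) where
  open CommutativeRing R hiding (zero)
  open Exp commutativeSemiring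
  open RingProperties ring
  open SetoidReasoning setoid
  open Solver commutativeSemiring using (solve; _:+_; _:*_; _:=_; con)

  ∏ : ℕ → (ℕ → Carrier) → Carrier
  ∏ zero    f = 1#
  ∏ (suc n) f = f (suc n) * ∏ n f

  ∏-cong : ∀ n {f g : ℕ → Carrier} → (∀ k → f (suc k) ≈ g (suc k)) → ∏ n f ≈ ∏ n g
  ∏-cong zero    f≈g = refl
  ∏-cong (suc n) f≈g = *-cong (f≈g n) (∏-cong n f≈g)

  ∏-* : ∀ n (f g : ℕ → Carrier) → ∏ n (λ k → f k * g k) ≈ ∏ n f * ∏ n g
  ∏-* zero    f g = sym (*-identityˡ 1#)
  ∏-* (suc n) f g = trans (*-congˡ (∏-* n f g))
    (solve 4 (λ a b c d → (a :* b) :* (c :* d) := (a :* c) :* (b :* d)) refl (f (suc n)) (g (suc n)) (∏ n f) (∏ n g))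

  -- Sum over the antidiagonal `a + b = n`; carrying both indices avoids truncated subtraction.
  ∑ᵃ : ℕ → (ℕ → ℕ → Carrier) → Carrier
  ∑ᵃ zero    f = f 0 0
  ∑ᵃ (suc n) f = f 0 (suc n) + ∑ᵃ n (λ a b → f (suc a) b)

  ∑ᵃ-cong : ∀ n {f g : ℕ → ℕ → Carrier} → (∀ a b → a ℕ.+ b ≡ n → f a b ≈ g a b) → ∑ᵃ n f ≈ ∑ᵃ n g
  ∑ᵃ-cong zero    f≈g = f≈g 0 0 ≡.refl
  ∑ᵃ-cong (suc n) f≈g =
    +-cong (f≈g 0 (suc n) ≡.refl) (∑ᵃ-cong n (λ a b eq → f≈g (suc a) b (≡.cong suc eq)))

  ∑ᵃ-+ : ∀ n (f g : ℕ → ℕ → Carrier) → ∑ᵃ n (λ a b → f a b + g a b) ≈ ∑ᵃ n f + ∑ᵃ n g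
  ∑ᵃ-+ zero    f g = refl
  ∑ᵃ-+ (suc n) f g = trans (+-congˡ (∑ᵃ-+ n _ _))
    (solve 4 (λ a b c d → (a :+ b) :+ (c :+ d) := (a :+ c) :+ (b :+ d)) refl (f 0 (suc n)) (g 0 (suc n)) _ _)

  ∑ᵃ-*ˡ : ∀ n x (f : ℕ → ℕ → Carrier) → ∑ᵃ n (λ a b → x * f a b) ≈ x * ∑ᵃ n f
  ∑ᵃ-*ˡ zero    x f = refl
  ∑ᵃ-*ˡ (suc n) x f = trans (+-congˡ (∑ᵃ-*ˡ n x _)) (sym (distribˡ x _ _))

  ∑ᵃ-snoc : ∀ n (f : ℕ → ℕ → Carrier) → ∑ᵃ (suc n) f ≈ ∑ᵃ n (λ a b → f a (suc b)) + f (suc n) 0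
  ∑ᵃ-snoc zero    f = refl
  ∑ᵃ-snoc (suc n) f = trans (+-congˡ (∑ᵃ-snoc n (λ a b → f (suc a) b))) (sym (+-assoc _ _ _))

  ∑ᵃ-flip : ∀ n (f : ℕ → ℕ → Carrier) → ∑ᵃ n f ≈ ∑ᵃ n (λ a b → f b a)
  ∑ᵃ-flip zero    f = refl
  ∑ᵃ-flip (suc n) f = begin
    f 0 (suc n) + ∑ᵃ n (λ a b → f (suc a) b)    ≈⟨ +-comm _ _ ⟩
    ∑ᵃ n (λ a b → f (suc a) b) + f 0 (suc n)    ≈⟨ +-congʳ (∑ᵃ-flip n _) ⟩
    ∑ᵃ n (λ a b → f (suc b) a) + f 0 (suc n)    ≈⟨ ∑ᵃ-snoc n (λ a b → f b a) ⟨
    ∑ᵃ (suc n) (λ a b → f b a)                  ∎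

  -- The pattern of Pascal's triangle: an entry `(a, b)` of row `n + 1` receives `f` from
  -- `(a - 1, b)` and `g` from `(a, b - 1)`, with a single parent at either end. Both inductions of
  -- `finite-jtp` are instances.
  ∑ᵃ-pascal : ∀ n (f g h : ℕ → ℕ → Carrier) →
    h 0 (suc n) ≈ g 0 n → h (suc n) 0 ≈ f n 0 →
    (∀ a b → suc (a ℕ.+ b) ≡ n → h (suc a) (suc b) ≈ f a (suc b) + g (suc a) b) →
    ∑ᵃ (suc n) h ≈ ∑ᵃ n f + ∑ᵃ n g
  ∑ᵃ-pascal zero f g h h₀ h₁ hᵢ = trans (+-cong h₀ h₁) (+-comm _ _)
  ∑ᵃ-pascal (suc n) f g h h₀ h₁ hᵢ = begin
    h 0 (suc (suc n)) + ∑ᵃ (suc n) (λ a b → h (suc a) b)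
      ≈⟨ +-cong h₀ (∑ᵃ-snoc n (λ a b → h (suc a) b)) ⟩
    g 0 (suc n) + (∑ᵃ n (λ a b → h (suc a) (suc b)) + h (suc (suc n)) 0)
      ≈⟨ +-congˡ (+-cong (∑ᵃ-cong n (λ a b eq → hᵢ a b (≡.cong suc eq))) h₁) ⟩
    g 0 (suc n) + (∑ᵃ n (λ a b → f a (suc b) + g (suc a) b) + f (suc n) 0)
      ≈⟨ +-congˡ (+-congʳ (∑ᵃ-+ n _ _)) ⟩
    g 0 (suc n) + ((∑ᵃ n (λ a b → f a (suc b)) + ∑ᵃ n (λ a b → g (suc a) b)) + f (suc n) 0)
      ≈⟨ solve 4 (λ x y z w → x :+ ((y :+ z) :+ w) := (y :+ w) :+ (x :+ z)) refl _ _ _ _ ⟩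
    (∑ᵃ n (λ a b → f a (suc b)) + f (suc n) 0) + (g 0 (suc n) + ∑ᵃ n (λ a b → g (suc a) b))
      ≈⟨ +-congʳ (∑ᵃ-snoc n f) ⟨
    ∑ᵃ (suc n) f + ∑ᵃ (suc n) g ∎

  ^-vanish : ∀ {x k n} → x ^ k ≈ 0# → k ℕ.≤ n → x ^ n ≈ 0#
  ^-vanish {x} {k} {n} x^k≈0 k≤n = begin
    x ^ n                      ≈⟨ ^-congʳ x (ℕ.m+[n∸m]≡n k≤n) ⟨
    x ^ (k ℕ.+ (n ℕ.∸ k))      ≈⟨ ^-homo-* x k (n ℕ.∸ k) ⟩
    x ^ k * x ^ (n ℕ.∸ k)      ≈⟨ *-congʳ x^k≈0 ⟩
    0# * x ^ (n ℕ.∸ k)         ≈⟨ zeroˡ _ ⟩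
    0#                         ∎

  clear : ∀ {x y w} → x ≈ y + w * x → (1# - w) * x ≈ y
  clear {x} {y} {w} eq = begin
    (1# - w) * x               ≈⟨ [y-z]x≈yx-zx x 1# w ⟩
    1# * x - w * x             ≈⟨ +-congʳ (trans (*-identityˡ x) eq) ⟩
    y + w * x - w * x          ≈⟨ +-assoc y _ _ ⟩
    y + (w * x - w * x)        ≈⟨ +-congˡ (-‿inverseʳ (w * x)) ⟩
    y + 0#                     ≈⟨ +-identityʳ y ⟩
    y                          ∎

  module _ (q : Carrier) where

    -- The Gaussian binomial coefficient [a + b choose a].
    gauss : ℕ → ℕ → Carrier
    gauss zero    b       = 1#
    gauss (suc a) zero    = 1#
    gauss (suc a) (suc b) = gauss a (suc b) + q ^ suc a * gauss (suc a) b

    gauss-zeroʳ : ∀ a → gauss a 0 ≈ 1#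
    gauss-zeroʳ zero    = refl
    gauss-zeroʳ (suc a) = refl

    -- The dual q-Pascal rule. The left side, expanded by the defining rule and then by induction,
    -- and the right side, expanded by the defining rule, involve the same three Gaussian
    -- coefficients with the same powers of `q`.
    gauss-pascal′ : ∀ a b → gauss (suc a) (suc b) ≈ gauss (suc a) b + q ^ suc b * gauss a (suc b)
    gauss-pascal′ zero    zero    = refl
    gauss-pascal′ zero    (suc b) = trans (+-congˡ (*-congˡ (gauss-pascal′ zero b)))
      (solve 3 (λ q g x → con 1 :+ (q :* con 1) :* (g :+ (q :* x) :* con 1)
                       := (con 1 :+ (q :* con 1) :* g) :+ (q :* (q :* x)) :* con 1)
             refl q (gauss 1 b) (q ^ b))
    gauss-pascal′ (suc a) zero    = trans (+-congʳ (gauss-pascal′ a zero))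
      (solve 3 (λ q g x → (con 1 :+ (q :* con 1) :* g) :+ (q :* (q :* x)) :* con 1
                       := con 1 :+ (q :* con 1) :* (g :+ (q :* x) :* con 1))
             refl q (gauss a 1) (q ^ a))
    gauss-pascal′ (suc a) (suc b) =
      trans (+-cong (gauss-pascal′ a (suc b)) (*-congˡ (gauss-pascal′ (suc a) b)))
      (solve 6 (λ q x y g g₁ g₂ →
           (g :+ (q :* (q :* y)) :* g₁) :+ (q :* (q :* x)) :* (g₂ :+ (q :* y) :* g)
        := (g :+ (q :* (q :* x)) :* g₂) :+ (q :* (q :* y)) :* (g₁ :+ (q :* x) :* g))
        refl q (q ^ a) (q ^ b) (gauss (suc a) (suc b)) (gauss a (suc (suc b))) (gauss (suc (suc a)) b))

    -- The factors `1 + u⁻¹ q ^ k` of the triple product, each multiplied by `u` to avoid inverses.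
    -- The exponents start at 0, unlike those in `∏`.
    ∏₀ : ℕ → Carrier → Carrier
    ∏₀ zero    u = 1#
    ∏₀ (suc B) u = (u + q ^ B) * ∏₀ B u

    ∏₀-∏ : ∀ B u → ∏₀ (suc B) u ≈ (u + 1#) * ∏ B (λ k → u + q ^ k)
    ∏₀-∏ zero    u = refl
    ∏₀-∏ (suc B) u = trans (*-congˡ (∏₀-∏ B u))
      (solve 3 (λ x y z → x :* (y :* z) := y :* (x :* z)) refl _ _ _)

    term : Carrier → ℕ → ℕ → ℕ → Carrier
    term u B a b = gauss a b * (u ^ a * q ^ T a B)

    -- Induction on `B` at `A = 0`, then on `A`. A new factor `u + q ^ B` is absorbed by the
    -- defining rule of `gauss`, a new factor `1 + u q ^ (A + 1)` by the dual rule; `T-step` and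
    -- `T-step′` match the exponents.
    finite-jtp : ∀ u A B → ∏ A (λ k → 1# + u * q ^ k) * ∏₀ B u ≈ ∑ᵃ (A ℕ.+ B) (term u B)
    finite-jtp u zero zero = sym (*-congˡ (*-identityˡ 1#))
    finite-jtp u zero (suc B) = begin
      1# * ((u + q ^ B) * ∏₀ B u)             ≈⟨ solve 3 (λ u x p → con 1 :* ((u :+ x) :* p) := u :* (con 1 :* p) :+ x :* (con 1 :* p)) refl u (q ^ B) (∏₀ B u) ⟩
      u * (1# * ∏₀ B u) + q ^ B * (1# * ∏₀ B u)
        ≈⟨ +-cong (*-congˡ (finite-jtp u zero B)) (*-congˡ (finite-jtp u zero B)) ⟩
      u * ∑ᵃ B (term u B) + q ^ B * ∑ᵃ B (term u B)
        ≈⟨ +-cong (∑ᵃ-*ˡ B u _) (∑ᵃ-*ˡ B (q ^ B) _) ⟨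
      ∑ᵃ B (λ a b → u * term u B a b) + ∑ᵃ B (λ a b → q ^ B * term u B a b)
        ≈⟨ ∑ᵃ-pascal B _ _ (term u (suc B)) first last inner ⟨
      ∑ᵃ (suc B) (term u (suc B)) ∎
      where
      first : term u (suc B) 0 (suc B) ≈ q ^ B * term u B 0 B
      first = trans (*-congˡ (*-congˡ (^-homo-* q B (T 0 B))))
        (solve 2 (λ x y → con 1 :* (con 1 :* (x :* y)) := x :* (con 1 :* (con 1 :* y))) refl _ _)
      last : term u (suc B) (suc B) 0 ≈ u * term u B B 0
      last = trans (solve 3 (λ u x y → con 1 :* ((u :* x) :* y) := u :* (con 1 :* (x :* y))) refl u (u ^ B) (q ^ T B B))
                   (*-congˡ (*-congʳ (sym (gauss-zeroʳ B))))
      inner : ∀ a b → suc (a ℕ.+ b) ≡ B →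
              term u (suc B) (suc a) (suc b) ≈ u * term u B a (suc b) + q ^ B * term u B (suc a) b
      inner a b eq = begin
        (g + x * h) * ((u * u ^ a) * t)
          ≈⟨ solve 6 (λ g x h u y t → (g :+ x :* h) :* ((u :* y) :* t) := u :* (g :* (y :* t)) :+ (t :* x) :* (h :* (u :* y)))
                   refl g x h u (u ^ a) t ⟩
        u * (g * (u ^ a * t)) + (t * x) * (h * (u * u ^ a))
          ≈⟨ +-congˡ (*-congʳ shift) ⟩
        u * (g * (u ^ a * t)) + (s * q ^ B) * (h * (u * u ^ a))
          ≈⟨ +-congˡ (solve 4 (λ s r h y → (s :* r) :* (h :* y) := r :* (h :* (y :* s))) refl s (q ^ B) h (u * u ^ a)) ⟩
        u * (g * (u ^ a * t)) + q ^ B * (h * ((u * u ^ a) * s)) ∎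
        where
        g = gauss a (suc b)
        h = gauss (suc a) b
        x = q ^ suc a
        t = q ^ T a B
        s = q ^ T (suc a) B
        shift : t * x ≈ s * q ^ B
        shift = trans (sym (^-homo-* q (T a B) (suc a)))
          (trans (^-congʳ q (≡.sym (T-step a B))) (^-homo-* q (T (suc a) B) B))
    finite-jtp u (suc A) B = begin
      ((1# + u * q ^ suc A) * ∏ A _) * ∏₀ B u
        ≈⟨ solve 3 (λ v x y → ((con 1 :+ v) :* x) :* y := v :* (x :* y) :+ x :* y) refl (u * q ^ suc A) _ _ ⟩
      (u * q ^ suc A) * (∏ A _ * ∏₀ B u) + ∏ A _ * ∏₀ B u
        ≈⟨ +-cong (*-congˡ (finite-jtp u A B)) (finite-jtp u A B) ⟩
      (u * q ^ suc A) * ∑ᵃ (A ℕ.+ B) (term u B) + ∑ᵃ (A ℕ.+ B) (term u B)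
        ≈⟨ +-congʳ (∑ᵃ-*ˡ (A ℕ.+ B) _ _) ⟨
      ∑ᵃ (A ℕ.+ B) (λ a b → (u * q ^ suc A) * term u B a b) + ∑ᵃ (A ℕ.+ B) (term u B)
        ≈⟨ ∑ᵃ-pascal (A ℕ.+ B) _ _ (term u B) refl last inner ⟨
      ∑ᵃ (suc A ℕ.+ B) (term u B) ∎
      where
      shift : ∀ a b → a ℕ.+ b ≡ A ℕ.+ B → q ^ T a B * q ^ suc A ≈ q ^ T (suc a) B * q ^ b
      shift a b eq = trans (sym (^-homo-* q (T a B) (suc A)))
          (trans (^-congʳ q (T-step′ {A} {B} a b eq)) (^-homo-* q (T (suc a) B) b))
      last : term u B (suc (A ℕ.+ B)) 0 ≈ (u * q ^ suc A) * term u B (A ℕ.+ B) 0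
      last = begin
        1# * ((u * u ^ N) * q ^ T (suc N) B)
          ≈⟨ solve 3 (λ u y s → con 1 :* ((u :* y) :* s) := (u :* y) :* (s :* con 1)) refl u (u ^ N) _ ⟩
        (u * u ^ N) * (q ^ T (suc N) B * 1#)
          ≈⟨ *-congˡ (shift N 0 (ℕ.+-identityʳ N)) ⟨
        (u * u ^ N) * (q ^ T N B * q ^ suc A)
          ≈⟨ solve 4 (λ u y t r → (u :* y) :* (t :* r) := (u :* r) :* (con 1 :* (y :* t))) refl u (u ^ N) _ _ ⟩
        (u * q ^ suc A) * (1# * (u ^ N * q ^ T N B))
          ≈⟨ *-congˡ (*-congʳ (gauss-zeroʳ N)) ⟨
        (u * q ^ suc A) * term u B N 0 ∎
        where N = A ℕ.+ B
      inner : ∀ a b → suc (a ℕ.+ b) ≡ A ℕ.+ B →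
              term u B (suc a) (suc b) ≈ (u * q ^ suc A) * term u B a (suc b) + term u B (suc a) b
      inner a b eq = begin
        gauss (suc a) (suc b) * ((u * u ^ a) * s)
          ≈⟨ *-congʳ (gauss-pascal′ a b) ⟩
        (h + x * g) * ((u * u ^ a) * s)
          ≈⟨ solve 6 (λ h x g u y s → (h :+ x :* g) :* ((u :* y) :* s) := (u :* (s :* x)) :* (g :* y) :+ h :* ((u :* y) :* s))
                   refl h x g u (u ^ a) s ⟩
        (u * (s * x)) * (g * u ^ a) + h * ((u * u ^ a) * s)
          ≈⟨ +-congʳ (*-congʳ (*-congˡ (shift a (suc b) (≡.trans (ℕ.+-suc a b) eq)))) ⟨
        (u * (t * r)) * (g * u ^ a) + h * ((u * u ^ a) * s)
          ≈⟨ +-congʳ (solve 5 (λ u t r g y → (u :* (t :* r)) :* (g :* y) := (u :* r) :* (g :* (y :* t))) refl u t r g (u ^ a)) ⟩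
        (u * r) * (g * (u ^ a * t)) + h * ((u * u ^ a) * s) ∎
        where
        g = gauss a (suc b)
        h = gauss (suc a) b
        x = q ^ suc b
        r = q ^ suc A
        t = q ^ T a B
        s = q ^ T (suc a) B

    qfac : ℕ → Carrier
    qfac n = ∏ n (λ k → 1# - q ^ k)

    -- The product is `(1 - q ^ (b + 1)) ⋯ (1 - q ^ (b + a))`, where all these powers of `q` vanish.
    -- The induction trades one unit of `a` for one of `b`.
    qfac-gauss : ∀ a b → q ^ suc b ≈ 0# → qfac a * gauss a b ≈ 1#
    qfac-gauss zero    b q^≈0 = *-identityˡ 1#
    qfac-gauss (suc a) b q^≈0 = begin
      ((1# - q ^ suc a) * qfac a) * gauss (suc a) b
        ≈⟨ solve 3 (λ x y z → (x :* y) :* z := y :* (x :* z)) refl _ _ _ ⟩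
      qfac a * ((1# - q ^ suc a) * gauss (suc a) b)
        ≈⟨ *-congˡ (clear stable) ⟩
      qfac a * gauss a (suc b)
        ≈⟨ qfac-gauss a (suc b) (^-vanish q^≈0 (ℕ.n≤1+n (suc b))) ⟩
      1# ∎
      where
      stable : gauss (suc a) b ≈ gauss (suc a) (suc b)
      stable = begin
        gauss (suc a) b                                  ≈⟨ +-identityʳ _ ⟨
        gauss (suc a) b + 0#                             ≈⟨ +-congˡ (trans (*-congʳ q^≈0) (zeroˡ _)) ⟨
        gauss (suc a) b + q ^ suc b * gauss a (suc b)    ≈⟨ gauss-pascal′ a b ⟨
        gauss (suc a) (suc b)                            ∎

    qfac-stable : ∀ {k} t → q ^ k ≈ 0# → qfac (t ℕ.+ k) ≈ qfac k
    qfac-stable         zero    q^≈0 = refl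
    qfac-stable {k} (suc t) q^≈0 = trans (*-cong factor (qfac-stable t q^≈0)) (*-identityˡ _)
      where
      factor : 1# - q ^ suc (t ℕ.+ k) ≈ 1#
      factor = trans (+-congˡ (trans (-‿cong (^-vanish q^≈0 (ℕ.m≤n⇒m≤1+n (ℕ.m≤n+m k t)))) -0#≈0#)) (+-identityʳ 1#)

    qfac-agree : ∀ {k m n} → q ^ k ≈ 0# → k ℕ.≤ m → k ℕ.≤ n → qfac m ≈ qfac n
    qfac-agree {k} q^≈0 k≤m k≤n = trans (at k≤m) (sym (at k≤n))
      where
      at : ∀ {n} → k ℕ.≤ n → qfac n ≈ qfac k
      at {n} k≤n = trans (reflexive (≡.cong qfac (≡.sym (ℕ.m∸n+n≡m k≤n)))) (qfac-stable (n ℕ.∸ k) q^≈0)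

    -- With `j = a - (A + 1)` the window is `-A - 1 ≤ j ≤ A`, which is stable under `j ↦ -1 - j`;
    -- hence the origin `suc A`. The powers of `u` carry a common extra factor `u ^ (A + 1)`.
    θ : Carrier → ℕ → Carrier
    θ u A = ∑ᵃ (A ℕ.+ suc A) (λ a b → u ^ a * q ^ T a (suc A))

    -- `A = 2 k` leaves two cases in a row. If both indices are at least `k`, then `qfac A` cancels
    -- the Gaussian coefficient. Otherwise the smaller index is below `k`, so `t ≥ k` and the power
    -- of `q` vanishes on both sides.
    jtp : ∀ u {k A} → q ^ k ≈ 0# → k ℕ.+ k ≡ A →
          qfac A * ((u + 1#) * (∏ A (λ i → 1# + u * q ^ i) * ∏ A (λ i → u + q ^ i))) ≈ θ u A
    jtp u {k} {A} q^k≈0 ≡.refl = begin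
      qfac A * ((u + 1#) * (∏ A (λ i → 1# + u * q ^ i) * ∏ A (λ i → u + q ^ i)))
        ≈⟨ *-congˡ (solve 3 (λ x y z → x :* (y :* z) := y :* (x :* z)) refl (u + 1#) _ _) ⟩
      qfac A * (∏ A (λ i → 1# + u * q ^ i) * ((u + 1#) * ∏ A (λ i → u + q ^ i)))
        ≈⟨ *-congˡ (*-congˡ (∏₀-∏ A u)) ⟨
      qfac A * (∏ A (λ i → 1# + u * q ^ i) * ∏₀ (suc A) u)
        ≈⟨ *-congˡ (finite-jtp u A (suc A)) ⟩
      qfac A * ∑ᵃ (A ℕ.+ suc A) (term u (suc A))
        ≈⟨ ∑ᵃ-*ˡ (A ℕ.+ suc A) (qfac A) _ ⟨
      ∑ᵃ (A ℕ.+ suc A) (λ a b → qfac A * term u (suc A) a b)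
        ≈⟨ ∑ᵃ-cong (A ℕ.+ suc A) (λ a b eq → collapse a b (row A a b eq)) ⟩
      θ u A ∎
      where
      k≤A : k ℕ.≤ A
      k≤A = ℕ.m≤m+n k k
      far : ∀ s t → s ℕ.+ t ≡ A → s ℕ.< k → k ℕ.≤ t
      far s t eq s<k = ℕ.+-cancelˡ-≤ k k t (ℕ.≤-trans (ℕ.≤-reflexive (≡.sym eq)) (ℕ.+-monoˡ-≤ t (ℕ.<⇒≤ s<k)))
      near : ∀ a b → k ℕ.≤ a → k ℕ.≤ b → qfac A * term u (suc A) a b ≈ u ^ a * q ^ T a (suc A)
      near a b k≤a k≤b = begin
        qfac A * (gauss a b * (u ^ a * q ^ T a (suc A)))   ≈⟨ *-assoc _ _ _ ⟨
        (qfac A * gauss a b) * (u ^ a * q ^ T a (suc A))   ≈⟨ *-congʳ (*-congʳ (qfac-agree q^k≈0 k≤A k≤a)) ⟩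
        (qfac a * gauss a b) * (u ^ a * q ^ T a (suc A))   ≈⟨ *-congʳ (qfac-gauss a b (^-vanish q^k≈0 (ℕ.m≤n⇒m≤1+n k≤b))) ⟩
        1# * (u ^ a * q ^ T a (suc A))                     ≈⟨ *-identityˡ _ ⟩
        u ^ a * q ^ T a (suc A)                            ∎
      negligible : ∀ a b t → T a (suc A) ≡ T t 0 → k ℕ.≤ t → qfac A * term u (suc A) a b ≈ u ^ a * q ^ T a (suc A)
      negligible a b t eq k≤t = trans
        (trans (*-congˡ (trans (*-congˡ (trans (*-congˡ q^≈0) (zeroʳ _))) (zeroʳ _))) (zeroʳ _))
        (sym (trans (*-congˡ q^≈0) (zeroʳ _)))
        where
        q^≈0 : q ^ T a (suc A) ≈ 0#
        q^≈0 = ^-vanish q^k≈0 (ℕ.≤-trans (ℕ.≤-trans k≤t (m≤T[m] t)) (ℕ.≤-reflexive (≡.sym eq)))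
      collapse : ∀ a b → Row A a b → qfac A * term u (suc A) a b ≈ u ^ a * q ^ T a (suc A)
      collapse _ b (right t _ eq) with k ℕ.≤? b
      ... | yes k≤b = near (suc A ℕ.+ t) b (ℕ.≤-trans (ℕ.m≤n⇒m≤1+n k≤A) (ℕ.m≤m+n (suc A) t)) k≤b
      ... | no  k≰b = negligible (suc A ℕ.+ t) b t (T-right (suc A) t) (far b t eq (ℕ.≰⇒> k≰b))
      collapse a _ (left t _ eq) with k ℕ.≤? a
      ... | yes k≤a = near a (suc A ℕ.+ t) k≤a (ℕ.≤-trans (ℕ.m≤n⇒m≤1+n k≤A) (ℕ.m≤m+n (suc A) t))
      ... | no  k≰a = negligible a (suc A ℕ.+ t) t (T-middle a t eq) (far a t eq (ℕ.≰⇒> k≰a))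

    -- Reversing the row exchanges `j` and `-1 - j`, which have the same triangular number. Every
    -- pair occurs twice, so no half of the row has to be singled out.
    2θ : ∀ u A → θ u A + θ u A ≈ ∑ᵃ (A ℕ.+ suc A) (λ a b → (u ^ a + u ^ b) * q ^ T a (suc A))
    2θ u A = begin
      θ u A + θ u A
        ≈⟨ +-congˡ (∑ᵃ-flip (A ℕ.+ suc A) _) ⟩
      θ u A + ∑ᵃ (A ℕ.+ suc A) (λ a b → u ^ b * q ^ T b (suc A))
        ≈⟨ ∑ᵃ-+ (A ℕ.+ suc A) _ _ ⟨
      ∑ᵃ (A ℕ.+ suc A) (λ a b → u ^ a * q ^ T a (suc A) + u ^ b * q ^ T b (suc A))
        ≈⟨ ∑ᵃ-cong (A ℕ.+ suc A) (λ a b eq → trans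
             (+-congˡ (*-congˡ (^-congʳ q (≡.sym (T-symmetric (row A a b eq)))))) (sym (distribʳ _ _ _))) ⟩
      ∑ᵃ (A ℕ.+ suc A) (λ a b → (u ^ a + u ^ b) * q ^ T a (suc A)) ∎

  -- A term of the doubled theta series with T ≢ 0, 1 (mod 5) has a − b an odd multiple of 5.
  2θ-lacunary : ∀ {u} → u ^ 5 ≈ - 1# → ∀ {A a b} → Row A a b →
                (T a (suc A) ℕ.% 5 ℕ.≤ 1) ⊎ (u ^ a + u ^ b ≈ 0#)
  2θ-lacunary {u} u⁵≈-1 {A} = λ where
      (right t b eq) → dichotomy t b eq (T-right (suc A) t)
      (left t a eq)  → [ inj₁ , (λ e → inj₂ (trans (+-comm _ _) e)) ]′ (dichotomy t a eq (T-middle a t eq))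
    where
    odd : ∀ s → u ^ (5 ℕ.* suc (2 ℕ.* s)) ≈ - 1#
    odd s = begin
      u ^ (5 ℕ.* suc (2 ℕ.* s))           ≈⟨ ^-assocʳ u 5 (suc (2 ℕ.* s)) ⟨
      (u ^ 5) ^ suc (2 ℕ.* s)             ≈⟨ ^-congˡ (suc (2 ℕ.* s)) u⁵≈-1 ⟩
      - 1# * (- 1#) ^ (2 ℕ.* s)           ≈⟨ *-congˡ (^-assocʳ (- 1#) 2 s) ⟨
      - 1# * ((- 1#) ^ 2) ^ s             ≈⟨ *-congˡ (^-congˡ s (trans (*-congˡ (*-identityʳ _)) (trans (-1*x≈-x _) (-‿involutive 1#)))) ⟩
      - 1# * 1# ^ s                       ≈⟨ *-congˡ (one s) ⟩
      - 1# * 1#                           ≈⟨ *-identityʳ _ ⟩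
      - 1#                                ∎
      where
      one : ∀ s → 1# ^ s ≈ 1#
      one zero    = refl
      one (suc s) = trans (*-identityˡ _) (one s)
    dichotomy : ∀ t b → b ℕ.+ t ≡ A → ∀ {e} → e ≡ T t 0 →
                (e ℕ.% 5 ℕ.≤ 1) ⊎ (u ^ (suc A ℕ.+ t) + u ^ b ≈ 0#)
    dichotomy t b ≡.refl ≡.refl with T-mod5 t
    ... | inj₁ small = inj₁ small
    ... | inj₂ (s , ≡.refl) = inj₂ (begin
      u ^ (suc (b ℕ.+ t) ℕ.+ t) + u ^ b             ≈⟨ +-congʳ (^-congʳ u (row-gap b s)) ⟩
      u ^ (5 ℕ.* suc (2 ℕ.* s) ℕ.+ b) + u ^ b       ≈⟨ +-congʳ (^-homo-* u (5 ℕ.* suc (2 ℕ.* s)) b) ⟩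
      u ^ (5 ℕ.* suc (2 ℕ.* s)) * u ^ b + u ^ b     ≈⟨ +-congʳ (trans (*-congʳ (odd s)) (-1*x≈-x _)) ⟩
      - (u ^ b) + u ^ b                             ≈⟨ -‿inverseˡ _ ⟩
      0#                                            ∎)

  [-1]² : - 1# * - 1# ≈ 1#
  [-1]² = trans (-1*x≈-x _) (-‿involutive 1#)
  [-1]⁵ : (- 1#) ^ 5 ≈ - 1#
  [-1]⁵ = trans (solve 1 (λ x → x :* (x :* (x :* (x :* (x :* con 1)))) := x :* ((x :* x) :* (x :* x))) refl (- 1#))
    (trans (*-congˡ (trans (*-cong [-1]² [-1]²) (*-identityˡ 1#))) (*-identityʳ _))

  -- Factorisation over a primitive fifth root of unity.

  module FifthRoot (z : Carrier) (Φ₅≈0 : 1# + (z + (z * z + (z * (z * z) + z * (z * (z * z))))) ≈ 0#) where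
    -- This is `(z - 1) Φ₅ = z⁵ - 1`, rearranged as `z⁵ + Φ₅ = 1 + z Φ₅` to stay free of
    -- subtraction.
    z⁵≈1 : z * (z * (z * (z * z))) ≈ 1#
    z⁵≈1 = begin
      z * (z * (z * (z * z)))                       ≈⟨ +-identityʳ _ ⟨
      z * (z * (z * (z * z))) + 0#                  ≈⟨ +-congˡ Φ₅≈0 ⟨
      z * (z * (z * (z * z))) + _                   ≈⟨ solve 1 (λ z → z :* (z :* (z :* (z :* z))) :+ (con 1 :+ (z :+ (z :* z :+ (z :* (z :* z) :+ z :* (z :* (z :* z))))))
                                                         := con 1 :+ z :* (con 1 :+ (z :+ (z :* z :+ (z :* (z :* z) :+ z :* (z :* (z :* z))))))) refl z ⟩
      1# + z * _                                    ≈⟨ +-congˡ (trans (*-congˡ Φ₅≈0) (zeroʳ z)) ⟩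
      1# + 0#                                       ≈⟨ +-identityʳ 1# ⟩
      1#                                            ∎

    -- With this sign `1 + u x` and `u + x` are `1 - z² x` and `u (1 - z⁻² x)`.
    u : Carrier
    u = - (z * z)
    z⁻¹ : Carrier
    z⁻¹ = z * (z * (z * z))

    u⁵≈-1 : u ^ 5 ≈ - 1#
    u⁵≈-1 = begin
      u ^ 5      ≈⟨ ^-congˡ 5 (sym (-1*x≈-x (z * z))) ⟩
      (- 1# * (z * z)) ^ 5 ≈⟨ ^-distrib-* (- 1#) (z * z) 5 ⟩
      (- 1#) ^ 5 * (z * z) ^ 5 ≈⟨ *-cong [-1]⁵ [z²]⁵ ⟩
      - 1# * 1# ≈⟨ *-identityʳ _ ⟩
      - 1# ∎
      where
      [z²]⁵ : (z * z) ^ 5 ≈ 1#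
      [z²]⁵ = trans (solve 1 (λ z → let w = z :* z in w :* (w :* (w :* (w :* (w :* con 1)))) := (z :* (z :* (z :* (z :* z)))) :* (z :* (z :* (z :* (z :* z))))) refl z)
        (trans (*-cong z⁵≈1 z⁵≈1) (*-identityˡ 1#))

    -- The factors are `1 - z ^ i x`, one for each fifth root of unity; the unit `u` is split off
    -- from `u + x`.
    quintic : ∀ x → ((1# - x) * ((1# + u * x) * (u + x))) * ((1# - z * x) * (1# - z⁻¹ * x)) ≈ u * (1# - x ^ 5)
    quintic x = begin
      ((1# + y) * ((1# + u * x) * (u + x))) * ((1# - z * x) * (1# - z⁻¹ * x))
        ≈⟨ *-cong (*-congˡ (*-cong (+-congˡ u*x) u+x)) (*-cong (+-congˡ (-‿distribʳ-* z x)) (+-congˡ (-‿distribʳ-* z⁻¹ x))) ⟩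
      ((1# + y) * ((1# + z² * y) * (u * (1# + z³ * y)))) * ((1# + z * y) * (1# + z⁻¹ * y))
        -- By the q-binomial theorem the coefficient of `y ^ k` in the product of the `1 + z ^ i y`
        -- is `z ^ (k (k - 1) / 2)` times the Gaussian coefficient `[5 choose k]` in `z`. For
        -- `0 < k < 5` the latter is a multiple of `[5 choose 1] = Φ₅`, which gives the explicit
        -- cofactor.
        ≈⟨ solve 3 (λ u z y →
             let z² = z :* z ; z³ = z :* z² ; z⁴ = z :* z³ ; y² = y :* y ; y³ = y :* y² ; y⁴ = y :* y³
                 z⁵ = z :* (z :* (z :* (z :* z))) in
             ((con 1 :+ y) :* ((con 1 :+ z² :* y) :* (u :* (con 1 :+ z³ :* y)))) :* ((con 1 :+ z :* y) :* (con 1 :+ z⁴ :* y))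
             := u :* ((con 1 :+ (z⁵ :* z⁵) :* (y :* (y :* (y :* (y :* (y :* con 1)))))) :+ (con 1 :+ (z :+ (z² :+ (z³ :+ z⁴))))
                  :* (y :+ (z :* (con 1 :+ z²) :* y² :+ (z³ :* (con 1 :+ z²) :* y³ :+ z³ :* z³ :* y⁴))))) refl u z y ⟩
      u * ((1# + (z⁵ * z⁵) * y ^ 5) + Φ₅ * _)
        ≈⟨ *-congˡ (+-cong (+-congˡ (trans (*-cong (trans (*-cong z⁵≈1 z⁵≈1) (*-identityˡ 1#)) y⁵) (*-identityˡ _)))
                           (trans (*-congʳ Φ₅≈0) (zeroˡ _))) ⟩
      u * ((1# - x ^ 5) + 0#)
        ≈⟨ *-congˡ (+-identityʳ _) ⟩
      u * (1# - x ^ 5) ∎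
      where
      y = - x
      z² = z * z
      z³ = z * z²
      z⁵ = z * (z * (z * (z * z)))
      Φ₅ = 1# + (z + (z * z + (z * (z * z) + z * (z * (z * z)))))
      u*x : u * x ≈ z² * y
      u*x = trans (sym (-‿distribˡ-* z² x)) (-‿distribʳ-* z² x)
      u+x : u + x ≈ u * (1# + z³ * y)
      u+x = begin
        u + x                      ≈⟨ +-congˡ (-‿involutive x) ⟨
        u + - y                    ≈⟨ +-congˡ (-‿cong (trans (*-congʳ z⁵≈1) (*-identityˡ y))) ⟨
        u + - (z⁵ * y)             ≈⟨ +-congˡ (-‿cong (solve 2 (λ z y → z :* (z :* (z :* (z :* z))) :* y := z :* z :* (z :* (z :* z) :* y)) refl z y)) ⟩
        u + - (z² * (z³ * y))      ≈⟨ +-congˡ (-‿distribˡ-* z² (z³ * y)) ⟩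
        u + u * (z³ * y)           ≈⟨ +-congʳ (*-identityʳ u) ⟨
        u * 1# + u * (z³ * y)      ≈⟨ distribˡ u 1# _ ⟨
        u * (1# + z³ * y)          ∎
      y⁵ : y ^ 5 ≈ - (x ^ 5)
      y⁵ = begin
        y ^ 5                  ≈⟨ ^-congˡ 5 (-1*x≈-x x) ⟨
        (- 1# * x) ^ 5         ≈⟨ ^-distrib-* (- 1#) x 5 ⟩
        (- 1#) ^ 5 * x ^ 5     ≈⟨ *-congʳ [-1]⁵ ⟩
        - 1# * x ^ 5           ≈⟨ -1*x≈-x _ ⟩
        - (x ^ 5)              ∎

-- Generating functions of partitions with parts divisible by `d`.

-- Lengths are strictly below `L`, so `partitions n` filters the case `L = suc n`, `M = n`.
decrListsUpTo : ℕ → ℕ → List (List ℕ)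
decrListsUpTo L M = concatMap (λ l → decrLists l M) (upTo L)

module PartitionSeries {c ℓ} (R : CommutativeRing c ℓ) where
  open CommutativeRing R hiding (zero)
  open Exp commutativeSemiring
  open RingProperties ring
  open SetoidReasoning setoid
  open Solver commutativeSemiring using (solve; _:+_; _:*_; _:=_; con)
  open TripleProduct R

  private variable
    X Y : Set

  ∑ : List X → (X → Carrier) → Carrier
  ∑ []       f = 0#
  ∑ (x ∷ xs) f = f x + ∑ xs f

  ∑-cong : ∀ (xs : List X) {f g} → (∀ x → f x ≈ g x) → ∑ xs f ≈ ∑ xs g
  ∑-cong []       f≈g = refl
  ∑-cong (x ∷ xs) f≈g = +-cong (f≈g x) (∑-cong xs f≈g)

  ∑-zero : ∀ (xs : List X) {f} → (∀ x → f x ≈ 0#) → ∑ xs f ≈ 0#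
  ∑-zero []       f≈0 = refl
  ∑-zero (x ∷ xs) f≈0 = trans (+-cong (f≈0 x) (∑-zero xs f≈0)) (+-identityˡ 0#)

  ∑-+ : ∀ (xs : List X) f g → ∑ xs (λ x → f x + g x) ≈ ∑ xs f + ∑ xs g
  ∑-+ []       f g = sym (+-identityˡ 0#)
  ∑-+ (x ∷ xs) f g = trans (+-congˡ (∑-+ xs f g))
    (solve 4 (λ a b c d → (a :+ b) :+ (c :+ d) := (a :+ c) :+ (b :+ d)) refl _ _ _ _)

  ∑-*ˡ : ∀ (xs : List X) y f → ∑ xs (λ x → y * f x) ≈ y * ∑ xs f
  ∑-*ˡ []       y f = sym (zeroʳ y)
  ∑-*ˡ (x ∷ xs) y f = trans (+-congˡ (∑-*ˡ xs y f)) (sym (distribˡ y _ _))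

  ∑-*ʳ : ∀ (xs : List X) y f → ∑ xs (λ x → f x * y) ≈ ∑ xs f * y
  ∑-*ʳ []       y f = sym (zeroˡ y)
  ∑-*ʳ (x ∷ xs) y f = trans (+-congˡ (∑-*ʳ xs y f)) (sym (distribʳ y _ _))

  ∑-++ : ∀ (xs ys : List X) f → ∑ (xs ++ ys) f ≈ ∑ xs f + ∑ ys f
  ∑-++ []       ys f = sym (+-identityˡ _)
  ∑-++ (x ∷ xs) ys f = trans (+-congˡ (∑-++ xs ys f)) (sym (+-assoc _ _ _))

  ∑-∷ʳ : ∀ (xs : List X) x f → ∑ (xs ∷ʳ x) f ≈ ∑ xs f + f x
  ∑-∷ʳ xs x f = trans (∑-++ xs (x ∷ []) f) (+-congˡ (+-identityʳ _))

  ∑-map : ∀ (h : X → Y) xs f → ∑ (map h xs) f ≈ ∑ xs (λ x → f (h x))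
  ∑-map h []       f = refl
  ∑-map h (x ∷ xs) f = +-congˡ (∑-map h xs f)

  ∑-concatMap : ∀ (h : X → List Y) xs f → ∑ (concatMap h xs) f ≈ ∑ xs (λ x → ∑ (h x) f)
  ∑-concatMap h []       f = refl
  ∑-concatMap h (x ∷ xs) f = trans (∑-++ (h x) _ f) (+-congˡ (∑-concatMap h xs f))

  ∑-filter : ∀ {p} {P : Pred X p} (P? : Decidable P) xs f →
             ∑ (filter P? xs) f ≈ ∑ xs (λ x → if does (P? x) then f x else 0#)
  ∑-filter P? []       f = refl
  ∑-filter P? (x ∷ xs) f with does (P? x)
  ... | true  = +-congˡ (∑-filter P? xs f)
  ... | false = trans (∑-filter P? xs f) (sym (+-identityˡ _))

  ∑-swap : ∀ (xs : List X) (ys : List Y) (f : X → Y → Carrier) →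
           ∑ xs (λ x → ∑ ys (f x)) ≈ ∑ ys (λ y → ∑ xs (λ x → f x y))
  ∑-swap []       ys f = sym (∑-zero ys (λ _ → refl))
  ∑-swap (x ∷ xs) ys f = trans (+-congˡ (∑-swap xs ys f)) (sym (∑-+ ys (f x) _))

  ∑-upTo-suc : ∀ n f → ∑ (upTo (suc n)) f ≈ ∑ (upTo n) f + f n
  ∑-upTo-suc n f = trans (reflexive (≡.cong (λ xs → ∑ xs f) (≡.sym (List.upTo-∷ʳ n)))) (∑-∷ʳ (upTo n) n f)

  ∑-upTo-cong : ∀ n {f g} → (∀ k → k ℕ.< n → f k ≈ g k) → ∑ (upTo n) f ≈ ∑ (upTo n) g
  ∑-upTo-cong zero    f≈g = refl
  ∑-upTo-cong (suc n) {f} {g} f≈g = begin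
    ∑ (upTo (suc n)) f    ≈⟨ ∑-upTo-suc n f ⟩
    ∑ (upTo n) f + f n    ≈⟨ +-cong (∑-upTo-cong n (λ k k<n → f≈g k (ℕ.m<n⇒m<1+n k<n))) (f≈g n ℕ.≤-refl) ⟩
    ∑ (upTo n) g + g n    ≈⟨ ∑-upTo-suc n g ⟨
    ∑ (upTo (suc n)) g    ∎

  if-cong : ∀ {b b′ x} → b ≡ b′ → (if b then x else 0#) ≈ (if b′ then x else 0#)
  if-cong eq = reflexive (≡.cong (if_then _ else 0#) eq)

  ∑-indicator-≥ : ∀ n {s} x → n ℕ.≤ s → ∑ (upTo n) (λ k → if does (s ℕ.≟ k) then x else 0#) ≈ 0#
  ∑-indicator-≥ zero        x n≤s = refl
  ∑-indicator-≥ (suc n) {s} x n<s = begin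
    ∑ (upTo (suc n)) _                                   ≈⟨ ∑-upTo-suc n _ ⟩
    ∑ (upTo n) _ + (if does (s ℕ.≟ n) then x else 0#)    ≈⟨ +-cong (∑-indicator-≥ n x (ℕ.<⇒≤ n<s))
      (if-cong (dec-false (s ℕ.≟ n) (ℕ.>⇒≢ n<s))) ⟩
    0# + 0#                                              ≈⟨ +-identityˡ 0# ⟩
    0#                                                   ∎

  ∑-indicator-< : ∀ n {s} x → s ℕ.< n → ∑ (upTo n) (λ k → if does (s ℕ.≟ k) then x else 0#) ≈ x
  ∑-indicator-< (suc n) {s} x s≤n = trans (∑-upTo-suc n _) step
    where
    step : ∑ (upTo n) (λ k → if does (s ℕ.≟ k) then x else 0#) + (if does (s ℕ.≟ n) then x else 0#) ≈ x
    step with s ℕ.≟ n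
    ... | yes s≡n = trans (+-cong (∑-indicator-≥ n x (ℕ.≤-reflexive (≡.sym s≡n))) (if-cong (dec-true (s ℕ.≟ n) s≡n))) (+-identityˡ x)
    ... | no  s≢n = trans (+-cong (∑-indicator-< n x (ℕ.≤∧≢⇒< (ℕ.≤-pred s≤n) s≢n)) (if-cong (dec-false (s ℕ.≟ n) s≢n))) (+-identityʳ x)

  -- The head is the largest entry, so the lists gained by raising the bound are those that start
  -- with `suc M`.
  ∑-decrLists-suc : ∀ l M f → ∑ (decrLists (suc l) (suc M)) f
                            ≈ ∑ (decrLists (suc l) M) f + ∑ (decrLists l (suc M)) (λ xs → f (suc M ∷ xs))
  ∑-decrLists-suc l M f = begin
    ∑ (concatMap h (applyUpTo suc (suc M))) f         ≈⟨ ∑-concatMap h (applyUpTo suc (suc M)) f ⟩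
    ∑ (applyUpTo suc (suc M)) g                       ≡⟨ ≡.cong (λ xs → ∑ xs g) (List.applyUpTo-∷ʳ suc M) ⟨
    ∑ (applyUpTo suc M ∷ʳ suc M) g                    ≈⟨ ∑-∷ʳ (applyUpTo suc M) (suc M) g ⟩
    ∑ (applyUpTo suc M) g + g (suc M)                 ≈⟨ +-cong (sym (∑-concatMap h (applyUpTo suc M) f)) (∑-map (suc M ∷_) (decrLists l (suc M)) f) ⟩
    ∑ (decrLists (suc l) M) f + ∑ (decrLists l (suc M)) (λ xs → f (suc M ∷ xs)) ∎
    where
    h : ℕ → List (List ℕ)
    h p = map (p ∷_) (decrLists l p)
    g : ℕ → Carrier
    g p = ∑ (h p) f

  ∑-decrListsUpTo-suc : ∀ L M f → ∑ (decrListsUpTo (suc L) M) f ≈ ∑ (decrListsUpTo L M) f + ∑ (decrLists L M) f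
  ∑-decrListsUpTo-suc L M f = begin
    ∑ (decrListsUpTo (suc L) M) f                           ≈⟨ ∑-concatMap (λ l → decrLists l M) (upTo (suc L)) f ⟩
    ∑ (upTo (suc L)) g                                      ≈⟨ ∑-upTo-suc L g ⟩
    ∑ (upTo L) g + g L                                      ≈⟨ +-congʳ (∑-concatMap (λ l → decrLists l M) (upTo L) f) ⟨
    ∑ (decrListsUpTo L M) f + ∑ (decrLists L M) f           ∎
    where
    g : ℕ → Carrier
    g l = ∑ (decrLists l M) f

  -- Entries are positive, so the sum of a list is at least its length.
  ∑-decrLists-long : ∀ l M f → (∀ xs → l ℕ.≤ sum xs → f xs ≈ 0#) → ∑ (decrLists l M) f ≈ 0#
  ∑-decrLists-long zero    M       f f≈0 = trans (+-identityʳ _) (f≈0 [] z≤n)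
  ∑-decrLists-long (suc l) zero    f f≈0 = refl
  ∑-decrLists-long (suc l) (suc M) f f≈0 = begin
    ∑ (decrLists (suc l) (suc M)) f ≈⟨ ∑-decrLists-suc l M f ⟩
    ∑ (decrLists (suc l) M) f + ∑ (decrLists l (suc M)) (λ xs → f (suc M ∷ xs))
      ≈⟨ +-cong (∑-decrLists-long (suc l) M f f≈0)
                (∑-decrLists-long l (suc M) _ (λ xs l≤ → f≈0 (suc M ∷ xs) (s≤s (ℕ.≤-trans l≤ (ℕ.m≤n+m (sum xs) M))))) ⟩
    0# + 0# ≈⟨ +-identityˡ 0# ⟩
    0# ∎

  ∑-decrLists-large : ∀ l M f → (∀ xs → M ℕ.< sum xs → f xs ≈ 0#) → ∑ (decrLists l (suc M)) f ≈ ∑ (decrLists l M) f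
  ∑-decrLists-large zero    M f f≈0 = refl
  ∑-decrLists-large (suc l) M f f≈0 = begin
    ∑ (decrLists (suc l) (suc M)) f ≈⟨ ∑-decrLists-suc l M f ⟩
    ∑ (decrLists (suc l) M) f + ∑ (decrLists l (suc M)) (λ xs → f (suc M ∷ xs))
      ≈⟨ +-congˡ (∑-zero (decrLists l (suc M)) (λ xs → f≈0 (suc M ∷ xs) (s≤s (ℕ.m≤m+n M (sum xs))))) ⟩
    ∑ (decrLists (suc l) M) f + 0# ≈⟨ +-identityʳ _ ⟩
    ∑ (decrLists (suc l) M) f ∎

  -- Every list gained has more than `n` entries or an entry above `n`, hence a sum above `n`.
  -- Partitions of different sizes can therefore be summed over one common list.
  ∑-decrListsUpTo-stable : ∀ {n} f → (∀ xs → n ℕ.< sum xs → f xs ≈ 0#) → ∀ L M →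
    ∑ (decrListsUpTo (L ℕ.+ suc n) (M ℕ.+ n)) f ≈ ∑ (decrListsUpTo (suc n) n) f
  ∑-decrListsUpTo-stable {n} f f≈0 zero zero    = refl
  ∑-decrListsUpTo-stable {n} f f≈0 zero (suc M) = begin
    ∑ (decrListsUpTo (suc n) (suc (M ℕ.+ n))) f
      ≈⟨ ∑-concatMap (λ l → decrLists l (suc (M ℕ.+ n))) (upTo (suc n)) f ⟩
    ∑ (upTo (suc n)) (λ l → ∑ (decrLists l (suc (M ℕ.+ n))) f)
      ≈⟨ ∑-cong (upTo (suc n)) (λ l → ∑-decrLists-large l (M ℕ.+ n) f
           (λ xs M+n< → f≈0 xs (ℕ.≤-<-trans (ℕ.m≤n+m n M) M+n<))) ⟩
    ∑ (upTo (suc n)) (λ l → ∑ (decrLists l (M ℕ.+ n)) f)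
      ≈⟨ ∑-concatMap (λ l → decrLists l (M ℕ.+ n)) (upTo (suc n)) f ⟨
    ∑ (decrListsUpTo (suc n) (M ℕ.+ n)) f
      ≈⟨ ∑-decrListsUpTo-stable f f≈0 zero M ⟩
    ∑ (decrListsUpTo (suc n) n) f ∎
  ∑-decrListsUpTo-stable {n} f f≈0 (suc L) M = begin
    ∑ (decrListsUpTo (suc (L ℕ.+ suc n)) (M ℕ.+ n)) f
      ≈⟨ ∑-decrListsUpTo-suc (L ℕ.+ suc n) (M ℕ.+ n) f ⟩
    ∑ (decrListsUpTo (L ℕ.+ suc n) (M ℕ.+ n)) f + ∑ (decrLists (L ℕ.+ suc n) (M ℕ.+ n)) f
      ≈⟨ +-cong (∑-decrListsUpTo-stable f f≈0 L M) (∑-decrLists-long (L ℕ.+ suc n) (M ℕ.+ n) f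
           (λ xs L+n< → f≈0 xs (ℕ.≤-trans (ℕ.m≤n+m (suc n) L) L+n<))) ⟩
    ∑ (decrListsUpTo (suc n) n) f + 0# ≈⟨ +-identityʳ _ ⟩
    ∑ (decrListsUpTo (suc n) n) f ∎

  monomial : Carrier → Carrier → List ℕ → Carrier
  monomial z q xs = z ^ length xs * q ^ sum xs

  module _ (z q : Carrier) (d : ℕ) where

    -- Divisibility enters as the value 0 instead of a filter, which makes the weight multiplicative
    -- in the parts.
    weight : List ℕ → Carrier
    weight xs = if does (all? (d ∣?_) xs) then monomial z q xs else 0#

    partWeight : ℕ → Carrier
    partWeight p = if does (d ∣? p) then z * q ^ p else 0#

    weight-∷ : ∀ p xs → weight (p ∷ xs) ≈ partWeight p * weight xs
    weight-∷ p xs with does (d ∣? p) | does (all? (d ∣?_) xs)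
    ... | true  | true  = trans (*-congˡ (^-homo-* q p (sum xs)))
      (solve 4 (λ z x y w → (z :* x) :* (y :* w) := (z :* y) :* (x :* w)) refl _ _ _ _)
    ... | true  | false = sym (zeroʳ _)
    ... | false | true  = sym (zeroˡ _)
    ... | false | false = sym (zeroˡ _)

    weight-vanish : ∀ {m} → q ^ suc m ≈ 0# → ∀ xs → m ℕ.< sum xs → weight xs ≈ 0#
    weight-vanish q^≈0 xs m< with does (all? (d ∣?_) xs)
    ... | true  = trans (*-congˡ (^-vanish q^≈0 m<)) (zeroʳ _)
    ... | false = refl

    series : ℕ → ℕ → Carrier
    series L M = ∑ (decrListsUpTo L M) weight

    -- Either no part equals `M + 1`, or one such part is removed, which lowers the length bound by
    -- one.
    series-suc : ∀ L M → series (suc L) (suc M) ≈ series (suc L) M + partWeight (suc M) * series L (suc M)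
    series-suc zero    M = sym (trans (+-congˡ (zeroʳ _)) (+-identityʳ _))
    series-suc (suc L) M = begin
      series (suc (suc L)) (suc M)
        ≈⟨ ∑-decrListsUpTo-suc (suc L) (suc M) weight ⟩
      series (suc L) (suc M) + ∑ (decrLists (suc L) (suc M)) weight
        ≈⟨ +-cong (series-suc L M) (∑-decrLists-suc L M weight) ⟩
      (series (suc L) M + w * series L (suc M)) + (∑ (decrLists (suc L) M) weight + ∑ (decrLists L (suc M)) (λ xs → weight (suc M ∷ xs)))
        ≈⟨ +-congˡ (+-congˡ (trans (∑-cong (decrLists L (suc M)) (weight-∷ (suc M))) (∑-*ˡ (decrLists L (suc M)) w weight))) ⟩
      (series (suc L) M + w * series L (suc M)) + (∑ (decrLists (suc L) M) weight + w * ∑ (decrLists L (suc M)) weight)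
        ≈⟨ solve 5 (λ s w t u v → (s :+ w :* t) :+ (u :+ w :* v) := (s :+ u) :+ w :* (t :+ v)) refl _ w _ _ _ ⟩
      (series (suc L) M + ∑ (decrLists (suc L) M) weight) + w * (series L (suc M) + ∑ (decrLists L (suc M)) weight)
        ≈⟨ +-cong (∑-decrListsUpTo-suc (suc L) M weight) (*-congˡ (∑-decrListsUpTo-suc L (suc M) weight)) ⟨
      series (suc (suc L)) M + w * series (suc L) (suc M) ∎
      where w = partWeight (suc M)

    module _ {m} (q^≈0 : q ^ suc m ≈ 0#) where

      series-stable : ∀ L M → m ℕ.< L → series (suc L) M ≈ series L M
      series-stable L M m<L = trans (∑-decrListsUpTo-suc L M weight)
        (trans (+-congˡ (∑-decrLists-long L M weight (λ xs L≤ → weight-vanish q^≈0 xs (ℕ.≤-trans m<L L≤)))) (+-identityʳ _))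

      -- Lists longer than `m` have weight 0, so the length bound can be held fixed. The recurrence
      -- then reads `S (M + 1) = S M + w * S (M + 1)`, and the factor `1 - w` eliminates the part
      -- size `M + 1`.
      ∏-series : ∀ L M → m ℕ.< L → ∏ M (λ p → 1# - partWeight p) * series L M ≈ 1#
      ∏-series (suc L) zero    m<L = trans (*-identityˡ _) (base L)
        where
        base : ∀ L → series (suc L) 0 ≈ 1#
        base zero    = trans (+-identityʳ _) (*-identityˡ _)
        base (suc L) = trans (∑-decrListsUpTo-suc (suc L) 0 weight) (trans (+-identityʳ _) (base L))
      ∏-series L (suc M) m<L = begin
        ((1# - partWeight (suc M)) * ∏ M _) * series L (suc M)
          ≈⟨ solve 3 (λ x y z → (x :* y) :* z := y :* (x :* z)) refl _ _ _ ⟩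
        ∏ M _ * ((1# - partWeight (suc M)) * series L (suc M))
          ≈⟨ *-congˡ (clear step) ⟩
        ∏ M _ * series L M
          ≈⟨ ∏-series L M m<L ⟩
        1# ∎
        where
        step : series L (suc M) ≈ series L M + partWeight (suc M) * series L (suc M)
        step = begin
          series L (suc M)                                        ≈⟨ series-stable L (suc M) m<L ⟨
          series (suc L) (suc M)                                  ≈⟨ series-suc L M ⟩
          series (suc L) M + partWeight (suc M) * series L (suc M) ≈⟨ +-congʳ (series-stable L M m<L) ⟩
          series L M + partWeight (suc M) * series L (suc M)      ∎

      -- The slack `M` allows the bound on the parts to be matched with the length of the product in
      -- `partition-inverse`.
      ∑-partitionsDivUpTo : ∀ M → ∑ (partitionsDivUpTo d m) (monomial z q) ≈ series (suc m) (M ℕ.+ m)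
      ∑-partitionsDivUpTo M = begin
        ∑ (partitionsDivUpTo d m) (monomial z q)
          ≈⟨ ∑-concatMap (partitionsDiv d) (upTo (suc m)) (monomial z q) ⟩
        ∑ (upTo (suc m)) (λ n → ∑ (partitionsDiv d n) (monomial z q))
          ≈⟨ ∑-upTo-cong (suc m) (λ n n≤m → layer n (ℕ.≤-pred n≤m)) ⟩
        ∑ (upTo (suc m)) (λ n → ∑ Λ (level n))
          ≈⟨ ∑-swap (upTo (suc m)) Λ level ⟩
        ∑ Λ (λ xs → ∑ (upTo (suc m)) (λ n → level n xs))
          ≈⟨ ∑-cong Λ collect ⟩
        series (suc m) (M ℕ.+ m) ∎
        where
        Λ = decrListsUpTo (suc m) (M ℕ.+ m)
        level : ℕ → List ℕ → Carrier
        level n xs = if does (sum xs ℕ.≟ n) then weight xs else 0#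
        level-vanish : ∀ n xs → n ℕ.< sum xs → level n xs ≈ 0#
        level-vanish n xs n< = if-cong (dec-false (sum xs ℕ.≟ n) (ℕ.>⇒≢ n<))
        layer : ∀ n → n ℕ.≤ m → ∑ (partitionsDiv d n) (monomial z q) ≈ ∑ Λ (level n)
        layer n n≤m = begin
          ∑ (partitionsDiv d n) (monomial z q)
            ≈⟨ ∑-filter (λ xs → all? (d ∣?_) xs) (partitions n) (monomial z q) ⟩
          ∑ (partitions n) weight
            ≈⟨ ∑-filter (λ xs → sum xs ℕ.≟ n) (decrListsUpTo (suc n) n) weight ⟩
          ∑ (decrListsUpTo (suc n) n) (level n)
            ≈⟨ ∑-decrListsUpTo-stable (level n) (level-vanish n) (m ℕ.∸ n) (M ℕ.+ m ℕ.∸ n) ⟨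
          ∑ (decrListsUpTo (m ℕ.∸ n ℕ.+ suc n) (M ℕ.+ m ℕ.∸ n ℕ.+ n)) (level n)
            ≡⟨ ≡.cong₂ (λ L M → ∑ (decrListsUpTo L M) (level n))
                 (≡.trans (ℕ.+-suc (m ℕ.∸ n) n) (≡.cong suc (ℕ.m∸n+n≡m n≤m)))
                 (ℕ.m∸n+n≡m (ℕ.≤-trans n≤m (ℕ.m≤n+m m M))) ⟩
          ∑ Λ (level n) ∎
        collect : ∀ xs → ∑ (upTo (suc m)) (λ n → level n xs) ≈ weight xs
        collect xs with sum xs ℕ.≤? m
        ... | yes s≤m = ∑-indicator-< (suc m) (weight xs) (s≤s s≤m)
        ... | no  s≰m = trans (∑-indicator-≥ (suc m) (weight xs) (ℕ.≰⇒> s≰m)) (sym (weight-vanish q^≈0 xs (ℕ.≰⇒> s≰m)))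

  module _ (z q : Carrier) (d′ : ℕ) where
    private d = suc d′

    -- Between consecutive multiples of `d` lie `d′` factors equal to 1, which `gap` removes.
    ∏-multiples : ∀ n → ∏ (n ℕ.* d) (λ p → 1# - partWeight z q d p) ≈ ∏ n (λ k → 1# - z * (q ^ d) ^ k)
    ∏-multiples zero    = refl
    ∏-multiples (suc n) = *-cong last (trans (gap d′ ℕ.≤-refl) (∏-multiples n))
      where
      last : 1# - partWeight z q d (d ℕ.+ n ℕ.* d) ≈ 1# - z * (q ^ d) ^ suc n
      last = +-congˡ (-‿cong (begin
        partWeight z q d (suc n ℕ.* d)   ≈⟨ if-cong (dec-true (d ∣? suc n ℕ.* d) (divides (suc n) ≡.refl)) ⟩
        z * q ^ (suc n ℕ.* d)            ≈⟨ *-congˡ (^-congʳ q (ℕ.*-comm (suc n) d)) ⟩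
        z * q ^ (d ℕ.* suc n)            ≈⟨ *-congˡ (^-assocʳ q d (suc n)) ⟨
        z * (q ^ d) ^ suc n              ∎))
      gap : ∀ t → t ℕ.≤ d′ → ∏ (t ℕ.+ n ℕ.* d) (λ p → 1# - partWeight z q d p) ≈ ∏ (n ℕ.* d) (λ p → 1# - partWeight z q d p)
      gap zero    t≤d′ = refl
      gap (suc t) t<d′ = trans (*-cong trivial (gap t (ℕ.<⇒≤ t<d′))) (*-identityˡ _)
        where
        nondivisible : ¬ (d ∣ suc t ℕ.+ n ℕ.* d)
        nondivisible d∣ = ℕ.<⇒≱ (s≤s t<d′)
          (∣⇒≤ (∣m+n∣m⇒∣n (≡.subst (d ∣_) (ℕ.+-comm (suc t) (n ℕ.* d)) d∣) (divides n ≡.refl)))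
        trivial : 1# - partWeight z q d (suc t ℕ.+ n ℕ.* d) ≈ 1#
        trivial = trans (+-congˡ (trans (-‿cong
          (if-cong (dec-false (d ∣? suc t ℕ.+ n ℕ.* d) nondivisible))) -0#≈0#)) (+-identityʳ 1#)

    partition-inverse : ∀ {m n} → q ^ suc m ≈ 0# → m ℕ.≤ n →
      ∏ n (λ k → 1# - z * (q ^ d) ^ k) * ∑ (partitionsDivUpTo d m) (monomial z q) ≈ 1#
    partition-inverse {m} {n} q^≈0 m≤n = begin
      ∏ n (λ k → 1# - z * (q ^ d) ^ k) * ∑ (partitionsDivUpTo d m) (monomial z q)
        ≈⟨ *-cong (sym (∏-multiples n)) (∑-partitionsDivUpTo z q d {m} q^≈0 (n ℕ.* d ℕ.∸ m)) ⟩
      ∏ (n ℕ.* d) (λ p → 1# - partWeight z q d p) * series z q d (suc m) (n ℕ.* d ℕ.∸ m ℕ.+ m)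
        ≡⟨ ≡.cong (λ M → ∏ (n ℕ.* d) (λ p → 1# - partWeight z q d p) * series z q d (suc m) M)
             (ℕ.m∸n+n≡m (ℕ.≤-trans m≤n (ℕ.m≤m*n n d))) ⟩
      ∏ (n ℕ.* d) (λ p → 1# - partWeight z q d p) * series z q d (suc m) (n ℕ.* d)
        ≈⟨ ∏-series z q d {m} q^≈0 (suc m) (n ℕ.* d) ℕ.≤-refl ⟩
      1# ∎

-- Factorisation of the rank series of 4-colored partitions.

quadruples : List (List ℕ) → List (List ℕ) → List Quad
quadruples C D =
  concatMap (λ r → concatMap (λ b → concatMap (λ y → map (λ o → r , b , y , o) D) D) C) C

-- Unfolds to the very list that `colored4` filters by size.
quads : ℕ → ℕ → ℕ → List Quad
quads c d m = quadruples (partitionsDivUpTo c m) (partitionsDivUpTo d m)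

-- Large enough for the truncated products to agree with the infinite ones modulo q ^ (m + 1).
cutoff : ℕ → ℕ
cutoff m = suc m ℕ.+ suc m

module RankSeries {c ℓ} (R : CommutativeRing c ℓ) where
  open CommutativeRing R hiding (zero)
  open Exp commutativeSemiring
  open SetoidReasoning setoid
  open Solver commutativeSemiring using (solve; _:+_; _:*_; _:=_; con)
  open TripleProduct R
  open PartitionSeries R

  quadWeight : Carrier → Carrier → Carrier → Quad → Carrier
  quadWeight z z′ q (r , b , y , o) =
    (monomial z q r * monomial z′ q b) * (monomial z q y * monomial z′ q o)

  module _ (z z′ q : Carrier) where

    pairSeries : List (List ℕ) → Carrier
    pairSeries L = ∑ L (monomial z q) * ∑ L (monomial z′ q)

    ∑-quadruples : ∀ C D → ∑ (quadruples C D) (quadWeight z z′ q) ≈ pairSeries C * pairSeries D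
    ∑-quadruples C D = begin
      ∑ (quadruples C D) w
        ≈⟨ ∑-concatMap (λ r → concatMap (λ b → concatMap (λ y → map (λ o → r , b , y , o) D) D) C) C w ⟩
      ∑ C (λ r → ∑ (concatMap (λ b → concatMap (λ y → map (λ o → r , b , y , o) D) D) C) w)
        ≈⟨ ∑-cong C (λ r → trans (∑-concatMap (λ b → concatMap (λ y → map (λ o → r , b , y , o) D) D) C w)
             (∑-cong C (λ b → trans (∑-concatMap (λ y → map (λ o → r , b , y , o) D) D w)
             (∑-cong D (λ y → ∑-map (λ o → r , b , y , o) D w))))) ⟩
      ∑ C (λ r → ∑ C (λ b → ∑ D (λ y → ∑ D (λ o → (α r * β b) * (α y * β o)))))
        ≈⟨ ∑-cong C (λ r → ∑-cong C (λ b → trans (∑-cong D (λ y → trans (∑-*ˡ D (α r * β b) (λ o → α y * β o))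
             (*-congˡ (∑-*ˡ D (α y) β)))) (trans (∑-*ˡ D (α r * β b) (λ y → α y * ∑ D β)) (*-congˡ (∑-*ʳ D (∑ D β) α))))) ⟩
      ∑ C (λ r → ∑ C (λ b → (α r * β b) * pairSeries D))
        ≈⟨ ∑-cong C (λ r → trans (∑-*ʳ C (pairSeries D) (λ b → α r * β b)) (*-congʳ (∑-*ˡ C (α r) β))) ⟩
      ∑ C (λ r → (α r * ∑ C β) * pairSeries D)
        ≈⟨ trans (∑-*ʳ C (pairSeries D) (λ r → α r * ∑ C β)) (*-congʳ (∑-*ʳ C (∑ C β) α)) ⟩
      pairSeries C * pairSeries D ∎
      where
      w : Quad → Carrier
      w = quadWeight z z′ q
      α β : List ℕ → Carrier
      α = monomial z q
      β = monomial z′ q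

  module _ (z q : Carrier) (Φ₅≈0 : 1# + (z + (z * z + (z * (z * z) + z * (z * (z * z))))) ≈ 0#) where
    open FifthRoot z Φ₅≈0

    -- What separates the theta series from the partition series: the factor `u + 1` of exponent 0,
    -- and one factor from `quintic` for each `k`. Apart from `u`, only fifth powers of `q ^ d`
    -- occur in it.
    multiplier : ℕ → ℕ → Carrier
    multiplier m d = (u + 1#) * ∏ (cutoff m) (λ k → u * (1# - ((q ^ d) ^ k) ^ 5))

    -- Each partition series times its product is 1. Inserting both into the triple product
    -- completes, for every `k`, the five factors of `quintic`.
    θ-pairSeries : ∀ m → q ^ suc m ≈ 0# → ∀ d′ → let d = suc d′; N = cutoff m in θ (q ^ d) u N ≈ multiplier m d * pairSeries z z⁻¹ q (partitionsDivUpTo d m)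
    θ-pairSeries m q^≈0 d′ = begin
      θ Q u N
        ≈⟨ jtp Q u {suc m} Q^≈0 ≡.refl ⟨
      F₁ * ((u + 1#) * (F₂ * F₃))
        ≈⟨ trans (*-congˡ (*-cong (partition-inverse z q d′ q^≈0 m≤N) (partition-inverse z⁻¹ q d′ q^≈0 m≤N)))
                 (trans (*-congˡ (*-identityˡ 1#)) (*-identityʳ _)) ⟨
      (F₁ * ((u + 1#) * (F₂ * F₃))) * ((F₄ * P) * (F₅ * P′))
        ≈⟨ solve 8 (λ v a b c d e x y → (a :* (v :* (b :* c))) :* ((d :* x) :* (e :* y))
                                      := (v :* ((a :* (b :* c)) :* (d :* e))) :* (x :* y)) refl (u + 1#) F₁ F₂ F₃ F₄ F₅ P P′ ⟩
      ((u + 1#) * ((F₁ * (F₂ * F₃)) * (F₄ * F₅))) * (P * P′)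
        ≈⟨ *-congʳ (*-congˡ merge) ⟨
      multiplier m d * (P * P′) ∎
      where
      N = cutoff m
      d = suc d′
      Q = q ^ d
      P = ∑ (partitionsDivUpTo d m) (monomial z q)
      P′ = ∑ (partitionsDivUpTo d m) (monomial z⁻¹ q)
      f₁ f₂ f₃ f₄ f₅ : ℕ → Carrier
      f₁ k = 1# - Q ^ k
      f₂ k = 1# + u * Q ^ k
      f₃ k = u + Q ^ k
      f₄ k = 1# - z * Q ^ k
      f₅ k = 1# - z⁻¹ * Q ^ k
      F₁ = ∏ N f₁
      F₂ = ∏ N f₂
      F₃ = ∏ N f₃
      F₄ = ∏ N f₄
      F₅ = ∏ N f₅
      m≤N : m ℕ.≤ N
      m≤N = ℕ.≤-trans (ℕ.n≤1+n m) (ℕ.m≤m+n (suc m) (suc m))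
      Q^≈0 : Q ^ suc m ≈ 0#
      Q^≈0 = trans (^-assocʳ q d (suc m)) (^-vanish q^≈0 (ℕ.m≤n*m (suc m) d))
      merge : ∏ N (λ k → u * (1# - (Q ^ k) ^ 5)) ≈ (F₁ * (F₂ * F₃)) * (F₄ * F₅)
      merge = begin
        ∏ N (λ k → u * (1# - (Q ^ k) ^ 5))
          ≈⟨ ∏-cong N (λ k → quintic (Q ^ suc k)) ⟨
        ∏ N (λ k → (f₁ k * (f₂ k * f₃ k)) * (f₄ k * f₅ k))
          ≈⟨ ∏-* N _ _ ⟩
        ∏ N (λ k → f₁ k * (f₂ k * f₃ k)) * ∏ N (λ k → f₄ k * f₅ k)
          ≈⟨ *-cong (trans (∏-* N f₁ _) (*-congˡ (∏-* N f₂ f₃))) (∏-* N f₄ f₅) ⟩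
        (F₁ * (F₂ * F₃)) * (F₄ * F₅) ∎

    θ-quads : ∀ m → q ^ suc m ≈ 0# → ∀ c′ d′ → let c = suc c′; d = suc d′; N = cutoff m in
      θ (q ^ c) u N * θ (q ^ d) u N ≈ multiplier m c * (multiplier m d * ∑ (quads c d m) (quadWeight z z⁻¹ q))
    θ-quads m q^≈0 c′ d′ = begin
      θ (q ^ suc c′) u N * θ (q ^ suc d′) u N
        ≈⟨ *-cong (θ-pairSeries m q^≈0 c′) (θ-pairSeries m q^≈0 d′) ⟩
      (M₁ * pairSeries z z⁻¹ q C) * (M₂ * pairSeries z z⁻¹ q D)
        ≈⟨ solve 4 (λ a b c d → (a :* b) :* (c :* d) := a :* (c :* (b :* d))) refl M₁ (pairSeries z z⁻¹ q C) M₂ (pairSeries z z⁻¹ q D) ⟩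
      M₁ * (M₂ * (pairSeries z z⁻¹ q C * pairSeries z z⁻¹ q D))
        ≈⟨ *-congˡ (*-congˡ (∑-quadruples z z⁻¹ q C D)) ⟨
      M₁ * (M₂ * ∑ (quadruples C D) (quadWeight z z⁻¹ q)) ∎
      where
      N = cutoff m
      M₁ M₂ : Carrier
      M₁ = multiplier m (suc c′)
      M₂ = multiplier m (suc d′)
      C D : List (List ℕ)
      C = partitionsDivUpTo (suc c′) m
      D = partitionsDivUpTo (suc d′) m

-- Coefficient model: polynomials in `q` and `z` acting on series.

-- The predecessor modulo 5: the coefficient of `z ^ r` in `z x` is that of `z ^ (r - 1)` in `x`.
ρ : Fin 5 → Fin 5
ρ 0F = 4F
ρ 1F = 0F
ρ 2F = 1F
ρ 3F = 2F
ρ 4F = 3F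

ρ⁵ : ∀ r → ρ (ρ (ρ (ρ (ρ r)))) ≡ r
ρ⁵ 0F = ≡.refl
ρ⁵ 1F = ≡.refl
ρ⁵ 2F = ≡.refl
ρ⁵ 3F = ≡.refl
ρ⁵ 4F = ≡.refl

-- x n r is the coefficient of q ^ n z ^ r, with the exponent r taken modulo 5.
Series : Set
Series = ℕ → Fin 5 → ℤ

-- Polynomials in q and z are compared through their action on Series,
-- so that no Cauchy product is needed.
data Poly : Set where
  𝟘 𝟙 𝕢 𝕫 : Poly
  _⊕_ _⊗_ : Poly → Poly → Poly
  ⊖_      : Poly → Poly

infixl 6 _⊕_
infixl 7 _⊗_
infix  8 ⊖_

⟦_⟧ : Poly → Series → Series
⟦ 𝟘 ⟧     x n       r = + 0
⟦ 𝟙 ⟧     x n       r = x n r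
⟦ 𝕢 ⟧     x zero    r = + 0
⟦ 𝕢 ⟧     x (suc n) r = x n r
⟦ 𝕫 ⟧     x n       r = x n (ρ r)
⟦ p ⊕ s ⟧ x n       r = ⟦ p ⟧ x n r ℤ.+ ⟦ s ⟧ x n r
⟦ p ⊗ s ⟧ x n       r = ⟦ p ⟧ (⟦ s ⟧ x) n r
⟦ ⊖ p ⟧   x n       r = ℤ.- ⟦ p ⟧ x n r

infix 4 _≐_
_≐_ : Series → Series → Set
x ≐ y = ∀ n r → x n r ≡ y n r

⟦⟧-cong : ∀ p {x y} → x ≐ y → ⟦ p ⟧ x ≐ ⟦ p ⟧ y
⟦⟧-cong 𝟘       x≐y n       r = ≡.refl
⟦⟧-cong 𝟙       x≐y n       r = x≐y n r
⟦⟧-cong 𝕢       x≐y zero    r = ≡.refl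
⟦⟧-cong 𝕢       x≐y (suc n) r = x≐y n r
⟦⟧-cong 𝕫       x≐y n       r = x≐y n (ρ r)
⟦⟧-cong (p ⊕ s) x≐y n       r = ≡.cong₂ ℤ._+_ (⟦⟧-cong p x≐y n r) (⟦⟧-cong s x≐y n r)
⟦⟧-cong (p ⊗ s) x≐y n       r = ⟦⟧-cong p (⟦⟧-cong s x≐y) n r
⟦⟧-cong (⊖ p)   x≐y n       r = ≡.cong ℤ.-_ (⟦⟧-cong p x≐y n r)

⟦⟧-zero : ∀ p → ⟦ p ⟧ (λ _ _ → + 0) ≐ λ _ _ → + 0
⟦⟧-zero 𝟘       n       r = ≡.refl
⟦⟧-zero 𝟙       n       r = ≡.refl
⟦⟧-zero 𝕢       zero    r = ≡.refl
⟦⟧-zero 𝕢       (suc n) r = ≡.refl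
⟦⟧-zero 𝕫       n       r = ≡.refl
⟦⟧-zero (p ⊕ s) n       r = ≡.cong₂ ℤ._+_ (⟦⟧-zero p n r) (⟦⟧-zero s n r)
⟦⟧-zero (p ⊗ s) n       r = ≡.trans (⟦⟧-cong p (⟦⟧-zero s) n r) (⟦⟧-zero p n r)
⟦⟧-zero (⊖ p)   n       r = ≡.cong ℤ.-_ (⟦⟧-zero p n r)

⟦⟧-+ : ∀ p x y → ⟦ p ⟧ (λ n r → x n r ℤ.+ y n r) ≐ λ n r → ⟦ p ⟧ x n r ℤ.+ ⟦ p ⟧ y n r
⟦⟧-+ 𝟘       x y n       r = ≡.refl
⟦⟧-+ 𝟙       x y n       r = ≡.refl
⟦⟧-+ 𝕢       x y zero    r = ≡.refl
⟦⟧-+ 𝕢       x y (suc n) r = ≡.refl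
⟦⟧-+ 𝕫       x y n       r = ≡.refl
⟦⟧-+ (p ⊕ s) x y n       r = ≡.trans (≡.cong₂ ℤ._+_ (⟦⟧-+ p x y n r) (⟦⟧-+ s x y n r)) (interchange (⟦ p ⟧ x n r) (⟦ p ⟧ y n r) (⟦ s ⟧ x n r) (⟦ s ⟧ y n r))
  where
  interchange : ∀ a b c d → (a ℤ.+ b) ℤ.+ (c ℤ.+ d) ≡ (a ℤ.+ c) ℤ.+ (b ℤ.+ d)
  interchange = ℤSolver.solve-∀
⟦⟧-+ (p ⊗ s) x y n       r = ≡.trans (⟦⟧-cong p (⟦⟧-+ s x y) n r) (⟦⟧-+ p (⟦ s ⟧ x) (⟦ s ⟧ y) n r)
⟦⟧-+ (⊖ p)   x y n       r = ≡.trans (≡.cong ℤ.-_ (⟦⟧-+ p x y n r)) (ℤ.neg-distrib-+ (⟦ p ⟧ x n r) _)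

⟦⟧-neg : ∀ p x → ⟦ p ⟧ (λ n r → ℤ.- x n r) ≐ λ n r → ℤ.- ⟦ p ⟧ x n r
⟦⟧-neg 𝟘       x n       r = ≡.refl
⟦⟧-neg 𝟙       x n       r = ≡.refl
⟦⟧-neg 𝕢       x zero    r = ≡.refl
⟦⟧-neg 𝕢       x (suc n) r = ≡.refl
⟦⟧-neg 𝕫       x n       r = ≡.refl
⟦⟧-neg (p ⊕ s) x n       r = ≡.trans (≡.cong₂ ℤ._+_ (⟦⟧-neg p x n r) (⟦⟧-neg s x n r)) (≡.sym (ℤ.neg-distrib-+ (⟦ p ⟧ x n r) _))
⟦⟧-neg (p ⊗ s) x n       r = ≡.trans (⟦⟧-cong p (⟦⟧-neg s x) n r) (⟦⟧-neg p (⟦ s ⟧ x) n r)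
⟦⟧-neg (⊖ p)   x n       r = ≡.cong ℤ.-_ (⟦⟧-neg p x n r)

⟦⟧-shift : ∀ p x → ⟦ p ⟧ (⟦ 𝕢 ⟧ x) ≐ ⟦ 𝕢 ⟧ (⟦ p ⟧ x)
⟦⟧-shift 𝟘       x zero    r = ≡.refl
⟦⟧-shift 𝟘       x (suc n) r = ≡.refl
⟦⟧-shift 𝟙       x zero    r = ≡.refl
⟦⟧-shift 𝟙       x (suc n) r = ≡.refl
⟦⟧-shift 𝕢       x n       r = ≡.refl
⟦⟧-shift 𝕫       x zero    r = ≡.refl
⟦⟧-shift 𝕫       x (suc n) r = ≡.refl
⟦⟧-shift (p ⊕ s) x zero    r = ≡.cong₂ ℤ._+_ (⟦⟧-shift p x zero r) (⟦⟧-shift s x zero r)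
⟦⟧-shift (p ⊕ s) x (suc n) r = ≡.cong₂ ℤ._+_ (⟦⟧-shift p x (suc n) r) (⟦⟧-shift s x (suc n) r)
⟦⟧-shift (p ⊗ s) x zero    r = ≡.trans (⟦⟧-cong p (⟦⟧-shift s x) zero r) (⟦⟧-shift p (⟦ s ⟧ x) zero r)
⟦⟧-shift (p ⊗ s) x (suc n) r = ≡.trans (⟦⟧-cong p (⟦⟧-shift s x) (suc n) r) (⟦⟧-shift p (⟦ s ⟧ x) (suc n) r)
⟦⟧-shift (⊖ p)   x zero    r = ≡.cong ℤ.-_ (⟦⟧-shift p x zero r)
⟦⟧-shift (⊖ p)   x (suc n) r = ≡.cong ℤ.-_ (⟦⟧-shift p x (suc n) r)

⟦⟧-rotate : ∀ p x → ⟦ p ⟧ (⟦ 𝕫 ⟧ x) ≐ ⟦ 𝕫 ⟧ (⟦ p ⟧ x)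
⟦⟧-rotate 𝟘       x n       r = ≡.refl
⟦⟧-rotate 𝟙       x n       r = ≡.refl
⟦⟧-rotate 𝕢       x zero    r = ≡.refl
⟦⟧-rotate 𝕢       x (suc n) r = ≡.refl
⟦⟧-rotate 𝕫       x n       r = ≡.refl
⟦⟧-rotate (p ⊕ s) x n       r = ≡.cong₂ ℤ._+_ (⟦⟧-rotate p x n r) (⟦⟧-rotate s x n r)
⟦⟧-rotate (p ⊗ s) x n       r = ≡.trans (⟦⟧-cong p (⟦⟧-rotate s x) n r) (⟦⟧-rotate p (⟦ s ⟧ x) n r)
⟦⟧-rotate (⊖ p)   x n       r = ≡.cong ℤ.-_ (⟦⟧-rotate p x n r)

-- Every action is additive and commutes with `𝕢` and `𝕫`, so induction on `p` suffices. Both the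
-- commutativity of `⊗` and its compatibility with the congruence rest on this.
⟦⟧-comm : ∀ p s x → ⟦ p ⟧ (⟦ s ⟧ x) ≐ ⟦ s ⟧ (⟦ p ⟧ x)
⟦⟧-comm 𝟘       s x n r = ≡.sym (⟦⟧-zero s n r)
⟦⟧-comm 𝟙       s x n r = ≡.refl
⟦⟧-comm 𝕢       s x n r = ≡.sym (⟦⟧-shift s x n r)
⟦⟧-comm 𝕫       s x n r = ≡.sym (⟦⟧-rotate s x n r)
⟦⟧-comm (p ⊕ t) s x n r = ≡.trans (≡.cong₂ ℤ._+_ (⟦⟧-comm p s x n r) (⟦⟧-comm t s x n r)) (≡.sym (⟦⟧-+ s (⟦ p ⟧ x) (⟦ t ⟧ x) n r))
⟦⟧-comm (p ⊗ t) s x n r = ≡.trans (⟦⟧-cong p (⟦⟧-comm t s x) n r) (⟦⟧-comm p s (⟦ t ⟧ x) n r)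
⟦⟧-comm (⊖ p)   s x n r = ≡.trans (≡.cong ℤ.-_ (⟦⟧-comm p s x n r)) (≡.sym (⟦⟧-neg s (⟦ p ⟧ x) n r))

-- (1 − z) x: its vanishing says that x is a multiple of 1 + z + z² + z³ + z⁴.
∇ : Series → Series
∇ x n r = x n r ℤ.- x n (ρ r)

∇-cong : ∀ {x y} → x ≐ y → ∇ x ≐ ∇ y
∇-cong x≐y n r = ≡.cong₂ ℤ._-_ (x≐y n r) (x≐y n (ρ r))

∇-+ : ∀ x y n r → ∇ (λ n r → x n r ℤ.+ y n r) n r ≡ ∇ x n r ℤ.+ ∇ y n r
∇-+ x y n r = lemma (x n r) (y n r) (x n (ρ r)) (y n (ρ r))
  where
  lemma : ∀ a b c d → (a ℤ.+ b) ℤ.- (c ℤ.+ d) ≡ (a ℤ.- c) ℤ.+ (b ℤ.- d)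
  lemma = ℤSolver.solve-∀

∇-neg : ∀ x n r → ∇ (λ n r → ℤ.- x n r) n r ≡ ℤ.- ∇ x n r
∇-neg x n r = lemma (x n r) (x n (ρ r))
  where
  lemma : ∀ a c → (ℤ.- a) ℤ.- (ℤ.- c) ≡ ℤ.- (a ℤ.- c)
  lemma = ℤSolver.solve-∀

-- The truncated ring, and cancellation of the multipliers.

module Truncated (m : ℕ) where

  -- Congruence modulo q ^ (m + 1) and 1 + z + z² + z³ + z⁴.
  infix 4 _≋_
  record _≋_ (p s : Poly) : Set where
    constructor congruent
    field at : ∀ x n r → n ℕ.≤ m → ∇ (⟦ p ⟧ x) n r ≡ ∇ (⟦ s ⟧ x) n r
  open _≋_ public

  fromActions : ∀ {p s} → (∀ x → ⟦ p ⟧ x ≐ ⟦ s ⟧ x) → p ≋ s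
  fromActions p≐s = congruent (λ x n r _ → ∇-cong (p≐s x) n r)

  isCommutativeRing : IsCommutativeRing _≋_ _⊕_ _⊗_ ⊖_ 𝟘 𝟙
  isCommutativeRing = record
    { isRing = record
      { +-isAbelianGroup = record
        { isGroup = record
          { isMonoid = record
            { isSemigroup = record
              { isMagma = record
                { isEquivalence = record
                  { refl  = congruent (λ _ _ _ _ → ≡.refl)
                  ; sym   = λ e → congruent (λ x n r n≤m → ≡.sym (at e x n r n≤m))
                  ; trans = λ e f → congruent (λ x n r n≤m → ≡.trans (at e x n r n≤m) (at f x n r n≤m))
                  }
                ; ∙-cong = λ {p} {p′} {s} {s′} e f → congruent (λ x n r n≤m → ≡.trans (∇-+ (⟦ p ⟧ x) (⟦ s ⟧ x) n r)
                    (≡.trans (≡.cong₂ ℤ._+_ (at e x n r n≤m) (at f x n r n≤m)) (≡.sym (∇-+ (⟦ p′ ⟧ x) (⟦ s′ ⟧ x) n r))))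
                }
              ; assoc = λ p s t → fromActions (λ x n r → ℤ.+-assoc (⟦ p ⟧ x n r) _ _)
              }
            ; identity = (λ p → fromActions (λ x n r → ℤ.+-identityˡ _)) , (λ p → fromActions (λ x n r → ℤ.+-identityʳ _))
            }
          ; inverse = (λ p → fromActions (λ x n r → ℤ.+-inverseˡ (⟦ p ⟧ x n r))) , (λ p → fromActions (λ x n r → ℤ.+-inverseʳ (⟦ p ⟧ x n r)))
          ; ⁻¹-cong = λ {p} {s} e → congruent (λ x n r n≤m → ≡.trans (∇-neg (⟦ p ⟧ x) n r)
              (≡.trans (≡.cong ℤ.-_ (at e x n r n≤m)) (≡.sym (∇-neg (⟦ s ⟧ x) n r))))
          }
        ; comm = λ p s → fromActions (λ x n r → ℤ.+-comm (⟦ p ⟧ x n r) _)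
        }
      -- `at` quantifies over all series, so the outer factor can be replaced at once; the inner one
      -- is first moved outwards by `⟦⟧-comm`.
      ; *-cong = λ {p} {p′} {s} {s′} e f → congruent (λ x n r n≤m → ≡.trans (at e (⟦ s ⟧ x) n r n≤m)
          (≡.trans (∇-cong (⟦⟧-comm p′ s x) n r) (≡.trans (at f (⟦ p′ ⟧ x) n r n≤m) (∇-cong (⟦⟧-comm s′ p′ x) n r))))
      ; *-assoc = λ p s t → fromActions (λ x n r → ≡.refl)
      ; *-identity = (λ p → fromActions (λ x n r → ≡.refl)) , (λ p → fromActions (λ x n r → ≡.refl))
      ; distrib = (λ p s t → fromActions (λ x → ⟦⟧-+ p (⟦ s ⟧ x) (⟦ t ⟧ x))) , (λ p s t → fromActions (λ x n r → ≡.refl))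
      }
    ; *-comm = λ p s → fromActions (⟦⟧-comm p s)
    }

  commutativeRing : CommutativeRing 0ℓ 0ℓ
  commutativeRing = record { isCommutativeRing = isCommutativeRing }

  open CommutativeRing commutativeRing using
    (commutativeSemiring; refl; sym; trans; +-congˡ; -‿cong; *-cong; *-congˡ; *-congʳ; *-assoc; distribˡ; distribʳ; zeroˡ; zeroʳ)
  open Exp commutativeSemiring
  open TripleProduct commutativeRing using (module FifthRoot; ∏; θ; ∑ᵃ; 2θ; 2θ-lacunary)
  open RankSeries commutativeRing
  open PartitionSeries commutativeRing using (∑)
  open Solver commutativeSemiring using (solve; _:+_; _:*_; _:=_; con)

  𝕢^-shift : ∀ k x n r → ⟦ 𝕢 ^ k ⟧ x (k ℕ.+ n) r ≡ x n r
  𝕢^-shift zero    x n r = ≡.refl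
  𝕢^-shift (suc k) x n r = 𝕢^-shift k x n r

  𝕢^-low : ∀ k x n r → n ℕ.< k → ⟦ 𝕢 ^ k ⟧ x n r ≡ + 0
  𝕢^-low (suc k) x zero    r n<k       = ≡.refl
  𝕢^-low (suc k) x (suc n) r (s≤s n<k) = 𝕢^-low k x n r n<k

  -- A multiple of `Φ₅` is invariant under `ρ`, hence killed by `∇`: `(1 - z) Φ₅ = 1 - z⁵`, and
  -- exponents of `z` count modulo 5.
  Φ₅≋0 : 𝟙 ⊕ (𝕫 ⊕ (𝕫 ⊗ 𝕫 ⊕ (𝕫 ⊗ (𝕫 ⊗ 𝕫) ⊕ 𝕫 ⊗ (𝕫 ⊗ (𝕫 ⊗ 𝕫))))) ≋ 𝟘
  Φ₅≋0 = congruent (λ x n r _ → telescope x n r)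
    where
    lemma : ∀ a b c d e → (a ℤ.+ (b ℤ.+ (c ℤ.+ (d ℤ.+ e)))) ℤ.- (b ℤ.+ (c ℤ.+ (d ℤ.+ (e ℤ.+ a)))) ≡ + 0
    lemma = ℤSolver.solve-∀
    telescope : ∀ x n r → ∇ (⟦ 𝟙 ⊕ (𝕫 ⊕ (𝕫 ⊗ 𝕫 ⊕ (𝕫 ⊗ (𝕫 ⊗ 𝕫) ⊕ 𝕫 ⊗ (𝕫 ⊗ (𝕫 ⊗ 𝕫))))) ⟧ x) n r ≡ + 0
    telescope x n r rewrite ρ⁵ r = lemma (x n r) (x n (ρ r)) (x n (ρ (ρ r))) (x n (ρ (ρ (ρ r)))) (x n (ρ (ρ (ρ (ρ r)))))

  𝕢^≋0 : 𝕢 ^ suc m ≋ 𝟘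
  𝕢^≋0 = congruent (λ x n r n≤m → ≡.cong₂ ℤ._-_ (𝕢^-low (suc m) x n r (s≤s n≤m)) (𝕢^-low (suc m) x n (ρ r) (s≤s n≤m)))

  open FifthRoot 𝕫 Φ₅≋0 using (u; u⁵≈-1; z⁻¹)

  δ : Series
  δ zero    0F = + 1
  δ _       _  = + 0

  -- Only exponents up to `m` are tested, which makes the property invariant under `≋`. By `flat`,
  -- the five entries at such an exponent agree.
  record Balanced (p : Poly) : Set where
    constructor balanced
    field flat : ∀ n r → n ℕ.≤ m → n ℕ.% 5 ≡ m ℕ.% 5 → ∇ (⟦ p ⟧ δ) n r ≡ + 0
  open Balanced public

  Balanced-resp : ∀ {p s} → p ≋ s → Balanced p → Balanced s
  Balanced-resp e b = balanced (λ n r n≤m n% → ≡.trans (≡.sym (at e δ n r n≤m)) (flat b n r n≤m n%))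

  Balanced-𝟘 : Balanced 𝟘
  Balanced-𝟘 = balanced (λ _ _ _ _ → ≡.refl)

  Balanced-⊕ : ∀ {p s} → Balanced p → Balanced s → Balanced (p ⊕ s)
  Balanced-⊕ {p} {s} b b′ = balanced (λ n r n≤m n% →
    ≡.trans (∇-+ (⟦ p ⟧ δ) (⟦ s ⟧ δ) n r) (≡.cong₂ ℤ._+_ (flat b n r n≤m n%) (flat b′ n r n≤m n%)))

  Balanced-⊖ : ∀ {p} → Balanced p → Balanced (⊖ p)
  Balanced-⊖ {p} b = balanced (λ n r n≤m n% → ≡.trans (∇-neg (⟦ p ⟧ δ) n r) (≡.cong ℤ.-_ (flat b n r n≤m n%)))

  Balanced-𝕢^ : ∀ {e} → e ℕ.% 5 ≢ m ℕ.% 5 → Balanced (𝕢 ^ e)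
  Balanced-𝕢^ {e} e≢m = balanced (λ n r n≤m n% →
    let n≢e = λ n≡e → e≢m (≡.trans (≡.cong (ℕ._% 5) (≡.sym n≡e)) n%) in ≡.cong₂ ℤ._-_ (off e n r n≢e) (off e n (ρ r) n≢e))
    where
    off : ∀ e n r → n ≢ e → ⟦ 𝕢 ^ e ⟧ δ n r ≡ + 0
    off zero    zero    r n≢e = contradiction ≡.refl n≢e
    off zero    (suc n) r n≢e = ≡.refl
    off (suc e) zero    r n≢e = ≡.refl
    off (suc e) (suc n) r n≢e = off e n r (λ n≡e → n≢e (≡.cong suc n≡e))

  -- `Reflecting s` is the substitute for division by `s`.
  Preserving Reflecting : Poly → Set
  Preserving s = ∀ {p} → Balanced p → Balanced (s ⊗ p)
  Reflecting s = ∀ {p} → Balanced (s ⊗ p) → Balanced p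

  Preserving-𝕫 : Preserving 𝕫
  Preserving-𝕫 b = balanced (λ n r → flat b n (ρ r))

  Preserving-⊗ : ∀ {s t} → Preserving s → Preserving t → Preserving (s ⊗ t)
  Preserving-⊗ {s} {t} ps pt {p} b = Balanced-resp (sym (*-assoc s t p)) (ps (pt b))

  Preserving-⊕ : ∀ {s t} → Preserving s → Preserving t → Preserving (s ⊕ t)
  Preserving-⊕ {s} {t} ps pt {p} b = Balanced-resp (sym (distribʳ p s t)) (Balanced-⊕ (ps b) (pt b))

  Preserving-^ : ∀ {s} → Preserving s → ∀ k → Preserving (s ^ k)
  Preserving-^ ps zero    b = balanced (flat b)
  Preserving-^ ps (suc k) b = Preserving-⊗ ps (Preserving-^ ps k) b

  Preserving-u : Preserving u
  Preserving-u {p} b = balanced (flat (Balanced-⊖ (Preserving-𝕫 (Preserving-𝕫 b))))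

  Reflecting-⊗ : ∀ {s t} → Reflecting s → Reflecting t → Reflecting (s ⊗ t)
  Reflecting-⊗ {s} {t} rs rt {p} b = rt (rs (Balanced-resp (*-assoc s t p) b))

  Reflecting-resp : ∀ {s t} → s ≋ t → Reflecting s → Reflecting t
  Reflecting-resp e rs b = rs (Balanced-resp (*-congʳ (sym e)) b)

  Reflecting-∏ : ∀ n (f : ℕ → Poly) → (∀ k → Reflecting (f (suc k))) → Reflecting (∏ n f)
  Reflecting-∏ zero    f rf b = balanced (flat b)
  Reflecting-∏ (suc n) f rf b = Reflecting-⊗ (rf n) (Reflecting-∏ n f rf) b

  Reflecting-u : Reflecting u
  -- Multiplication by `z²` reads the entry at `ρ (ρ r)`; starting three steps further makes a full
  -- turn of five.
  Reflecting-u {p} b = balanced (λ n r n≤m n% → ≡.subst (λ r → ∇ (⟦ p ⟧ δ) n r ≡ + 0) (ρ⁵ r)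
    (negative (⟦ p ⟧ δ n _) _ (flat b n (ρ (ρ (ρ r))) n≤m n%)))
    where
    negative : ∀ a c → (ℤ.- a) ℤ.- (ℤ.- c) ≡ + 0 → a ℤ.- c ≡ + 0
    negative a c e = ≡.trans (lemma a c) (≡.cong ℤ.-_ e)
      where
      lemma : ∀ a c → a ℤ.- c ≡ ℤ.- ((ℤ.- a) ℤ.- (ℤ.- c))
      lemma = ℤSolver.solve-∀

  k*i≡0⇒i≡0 : ∀ k i → + suc k ℤ.* i ≡ + 0 → i ≡ + 0
  k*i≡0⇒i≡0 k i e with ℤ.i*j≡0⇒i≡0∨j≡0 (+ suc k) e
  ... | inj₂ i≡0 = i≡0

  -- If y = (1 − z) x satisfies y = z² y, then y is constant on residues, and it has sum 0.
  Reflecting-1+u : Reflecting (u ⊕ 𝟙)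
  Reflecting-1+u {p} b = balanced (λ n r n≤m n% → k*i≡0⇒i≡0 4 _ (five (⟦ p ⟧ δ n) (λ r → flat b n r n≤m n%) r))
    where
    h : ℤ → ℤ → ℤ → ℤ → ℤ
    h a b c d = (ℤ.- c ℤ.+ a) ℤ.- (ℤ.- d ℤ.+ b)
    -- The weights 4, 3, 2, 1, 0 run along the orbit of `ρ²`, that is, through the hypotheses at
    -- positions 0, 2, 4, 1, 3. They come from `(1 - ζ²) (4 + 3 ζ² + 2 ζ⁴ + ζ⁶) = 5`.
    lemma : ∀ a b c d e → + 5 ℤ.* (a ℤ.- b) ≡
      + 4 ℤ.* ((ℤ.- c ℤ.+ a) ℤ.- (ℤ.- d ℤ.+ b)) ℤ.+ ((ℤ.- d ℤ.+ b) ℤ.- (ℤ.- e ℤ.+ c))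
      ℤ.+ + 3 ℤ.* ((ℤ.- e ℤ.+ c) ℤ.- (ℤ.- a ℤ.+ d)) ℤ.+ + 2 ℤ.* ((ℤ.- b ℤ.+ e) ℤ.- (ℤ.- c ℤ.+ a))
    lemma = ℤSolver.solve-∀
    orbit : ∀ a b c d e → h a b c d ≡ + 0 → h b c d e ≡ + 0 → h c d e a ≡ + 0 → h e a b c ≡ + 0 → + 5 ℤ.* (a ℤ.- b) ≡ + 0
    orbit a b c d e h₀ h₁ h₂ h₄ = ≡.trans (lemma a b c d e) (≡.cong₂ ℤ._+_ (≡.cong₂ ℤ._+_ (≡.cong₂ ℤ._+_
      (≡.cong (+ 4 ℤ.*_) h₀) h₁) (≡.cong (+ 3 ℤ.*_) h₂)) (≡.cong (+ 2 ℤ.*_) h₄))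
    five : ∀ (x : Fin 5 → ℤ) → (∀ r → h (x r) (x (ρ r)) (x (ρ (ρ r))) (x (ρ (ρ (ρ r)))) ≡ + 0) →
           ∀ r → + 5 ℤ.* (x r ℤ.- x (ρ r)) ≡ + 0
    five x h≡0 0F = orbit _ _ _ _ (x 1F) (h≡0 0F) (h≡0 4F) (h≡0 3F) (h≡0 1F)
    five x h≡0 1F = orbit _ _ _ _ (x 2F) (h≡0 1F) (h≡0 0F) (h≡0 4F) (h≡0 2F)
    five x h≡0 2F = orbit _ _ _ _ (x 3F) (h≡0 2F) (h≡0 1F) (h≡0 0F) (h≡0 3F)
    five x h≡0 3F = orbit _ _ _ _ (x 4F) (h≡0 3F) (h≡0 2F) (h≡0 1F) (h≡0 4F)
    five x h≡0 4F = orbit _ _ _ _ (x 0F) (h≡0 4F) (h≡0 3F) (h≡0 2F) (h≡0 0F)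

  Balanced-half : ∀ {p} → Balanced (p ⊕ p) → Balanced p
  Balanced-half {p} b = balanced (λ n r n≤m n% → k*i≡0⇒i≡0 1 _ (≡.trans (lemma (⟦ p ⟧ δ n r) (⟦ p ⟧ δ n (ρ r))) (flat b n r n≤m n%)))
    where
    lemma : ∀ a b → + 2 ℤ.* (a ℤ.- b) ≡ (a ℤ.+ a) ℤ.- (b ℤ.+ b)
    lemma = ℤSolver.solve-∀

  -- The coefficient of the product at `n` is that of `p` at `n` minus that at `n - E`. As 5 divides
  -- `E` and `E > 0`, the latter exponent is smaller and in the same class, so strong induction
  -- applies.
  Reflecting-1-𝕢^ : ∀ e → Reflecting (𝟙 ⊕ ⊖ (𝕢 ^ (suc e ℕ.* 5)))
  Reflecting-1-𝕢^ e {p} b = balanced (<-rec _ step)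
    where
    E = suc e ℕ.* 5
    x = ⟦ p ⟧ δ
    split : ∀ n r → ∇ (⟦ (𝟙 ⊕ ⊖ (𝕢 ^ E)) ⊗ p ⟧ δ) n r ≡ ∇ x n r ℤ.- ∇ (⟦ 𝕢 ^ E ⟧ x) n r
    split n r = ≡.trans (∇-+ x (⟦ ⊖ (𝕢 ^ E) ⟧ x) n r) (≡.cong (λ y → ∇ x n r ℤ.+ y) (∇-neg (⟦ 𝕢 ^ E ⟧ x) n r))
    Flat : ℕ → Set
    Flat n = ∀ r → n ℕ.≤ m → n ℕ.% 5 ≡ m ℕ.% 5 → ∇ x n r ≡ + 0
    step : ∀ n → (∀ {k} → k ℕ.< n → Flat k) → Flat n
    step n ih r n≤m n% = ≡.trans (ℤ.i-j≡0⇒i≡j _ _ (≡.trans (≡.sym (split n r)) (flat b n r n≤m n%))) earlier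
      where
      earlier : ∇ (⟦ 𝕢 ^ E ⟧ x) n r ≡ + 0
      earlier with E ℕ.≤? n
      ... | no  E≰n = ≡.cong₂ ℤ._-_ (𝕢^-low E x n r (ℕ.≰⇒> E≰n)) (𝕢^-low E x n (ρ r) (ℕ.≰⇒> E≰n))
      ... | yes E≤n with k , ≡.refl ← ℕ.m≤n⇒∃[o]m+o≡n E≤n =
        ≡.trans (≡.cong₂ ℤ._-_ (𝕢^-shift E x k r) (𝕢^-shift E x k (ρ r)))
          (ih (ℕ.m<n+m k (s≤s z≤n)) r (ℕ.≤-trans (ℕ.m≤n+m k E) n≤m) (≡.trans (≡.sym k%) n%))
        where
        k% : (E ℕ.+ k) ℕ.% 5 ≡ k ℕ.% 5
        k% = ≡.trans (≡.cong (ℕ._% 5) (ℕ.+-comm E k)) ([m+kn]%n≡m%n k (suc e) 5)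

  Reflecting-multiplier : ∀ d′ → Reflecting (multiplier 𝕫 𝕢 Φ₅≋0 m (suc d′))
  Reflecting-multiplier d′ = Reflecting-⊗ Reflecting-1+u (Reflecting-∏ (cutoff m) _ factor)
    where
    exponent : ∀ k → ((𝕢 ^ suc d′) ^ suc k) ^ 5 ≋ 𝕢 ^ (suc d′ ℕ.* suc k ℕ.* 5)
    exponent k = trans (^-congˡ 5 (^-assocʳ 𝕢 (suc d′) (suc k))) (^-assocʳ 𝕢 (suc d′ ℕ.* suc k) 5)
    factor : ∀ k → Reflecting (u ⊗ (𝟙 ⊕ ⊖ (((𝕢 ^ suc d′) ^ suc k) ^ 5)))
    -- `suc d′ * suc k` unfolds to `suc (k + d′ * suc k)`, the positive form that `Reflecting-1-𝕢^`
    -- expects.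
    factor k = Reflecting-⊗ Reflecting-u
      (Reflecting-resp (+-congˡ (-‿cong (sym (exponent k)))) (Reflecting-1-𝕢^ (k ℕ.+ d′ ℕ.* suc k)))

  -- Of the coefficient `s`, which will be `u ^ a ⊕ u ^ b`, only the fact that it respects balance
  -- is remembered.
  data Lacunary (d : ℕ) (p : Poly) : Set where
    null : p ≋ 𝟘 → Lacunary d p
    term : ∀ {s} e → Preserving s → e ℕ.% 5 ℕ.≤ 1 → p ≋ s ⊗ (𝕢 ^ d) ^ e → Lacunary d p
    plus : ∀ {s t} → p ≋ s ⊕ t → Lacunary d s → Lacunary d t → Lacunary d p

  Lacunary-∑ᵃ : ∀ {d} n f → (∀ a b → a ℕ.+ b ≡ n → Lacunary d (f a b)) → Lacunary d (∑ᵃ n f)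
  Lacunary-∑ᵃ zero    f lf = lf 0 0 ≡.refl
  Lacunary-∑ᵃ (suc n) f lf = plus refl (lf 0 (suc n) ≡.refl)
    (Lacunary-∑ᵃ n (λ a b → f (suc a) b) (λ a b eq → lf (suc a) b (≡.cong suc eq)))

  Lacunary-2θ : ∀ d A → Lacunary d (θ (𝕢 ^ d) u A ⊕ θ (𝕢 ^ d) u A)
  Lacunary-2θ d A = resp (2θ (𝕢 ^ d) u A) (Lacunary-∑ᵃ (A ℕ.+ suc A) _ summand)
    where
    resp : ∀ {p s} → p ≋ s → Lacunary d s → Lacunary d p
    resp e (null z)          = null (trans e z)
    resp e (term k ps k% f)  = term k ps k% (trans e f)
    resp e (plus f l l′)     = plus (trans e f) l l′
    summand : ∀ a b → a ℕ.+ b ≡ A ℕ.+ suc A → Lacunary d ((u ^ a ⊕ u ^ b) ⊗ (𝕢 ^ d) ^ T a (suc A))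
    summand a b eq =
      [ (λ small → term (T a (suc A)) (Preserving-⊕ (Preserving-^ Preserving-u a) (Preserving-^ Preserving-u b)) small refl)
      , (λ u≋0 → null (trans (*-congʳ u≋0) (zeroˡ _)))
      ]′ (2θ-lacunary u⁵≈-1 (row A a b eq))

  -- Expanding both factors leaves monomials of degree `c e + d f`, each balanced because its degree
  -- avoids the class of `m`; the coefficients in front preserve this.
  Balanced-⊗ : ∀ {c d} → (∀ e f → e ℕ.% 5 ℕ.≤ 1 → f ℕ.% 5 ℕ.≤ 1 → (c ℕ.* e ℕ.+ d ℕ.* f) ℕ.% 5 ≢ m ℕ.% 5) →
    ∀ {p s} → Lacunary c p → Lacunary d s → Balanced (p ⊗ s)
  Balanced-⊗ avoid {p} {s} (null z)      l = Balanced-resp (sym (trans (*-congʳ z) (zeroˡ s))) Balanced-𝟘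
  Balanced-⊗ avoid {p} {s} (plus {a} {b} e l₁ l₂) l = Balanced-resp (sym (trans (*-congʳ e) (distribʳ s a b)))
    (Balanced-⊕ (Balanced-⊗ avoid l₁ l) (Balanced-⊗ avoid l₂ l))
  Balanced-⊗ avoid {p} {s} l@(term _ _ _ _) (null z)      = Balanced-resp (sym (trans (*-congˡ z) (zeroʳ p))) Balanced-𝟘
  Balanced-⊗ avoid {p} {s} l@(term _ _ _ _) (plus {a} {b} e l₁ l₂) = Balanced-resp (sym (trans (*-congˡ e) (distribˡ p a b)))
    (Balanced-⊕ (Balanced-⊗ avoid l l₁) (Balanced-⊗ avoid l l₂))
  Balanced-⊗ {c} {d} avoid {p} {s} (term {a} e pa e% p≋) (term {b} f pb f% s≋) =
    Balanced-resp (sym rearranged) (Preserving-⊗ pa pb (Balanced-𝕢^ {c ℕ.* e ℕ.+ d ℕ.* f} (avoid e f e% f%)))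
    where
    rearranged : p ⊗ s ≋ (a ⊗ b) ⊗ 𝕢 ^ (c ℕ.* e ℕ.+ d ℕ.* f)
    rearranged = trans (*-cong p≋ s≋) (trans
      (solve 4 (λ a x b y → (a :* x) :* (b :* y) := (a :* b) :* (x :* y)) refl a ((𝕢 ^ c) ^ e) b ((𝕢 ^ d) ^ f))
      (*-congˡ (trans (*-cong (^-assocʳ 𝕢 c e) (^-assocʳ 𝕢 d f)) (sym (^-homo-* 𝕢 (c ℕ.* e) (d ℕ.* f))))))

  Balanced-quads : ∀ c′ d′ → let c = suc c′; d = suc d′ in
    (∀ e f → e ℕ.% 5 ℕ.≤ 1 → f ℕ.% 5 ℕ.≤ 1 → (c ℕ.* e ℕ.+ d ℕ.* f) ℕ.% 5 ≢ m ℕ.% 5) →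
    Balanced (∑ (quads c d m) (quadWeight 𝕫 z⁻¹ 𝕢))
  Balanced-quads c′ d′ avoid =
    Reflecting-multiplier d′ (Reflecting-multiplier c′ (Balanced-resp (θ-quads 𝕫 𝕢 Φ₅≋0 m 𝕢^≋0 c′ d′)
      -- Both theta series are doubled, so their product carries a factor 4, which two halvings
      -- remove.
      (Balanced-half (Balanced-half (Balanced-resp
        (solve 2 (λ a b → (a :+ a) :* (b :+ b) := (a :* b :+ a :* b) :+ (a :* b :+ a :* b)) refl θc θd)
        (Balanced-⊗ avoid (Lacunary-2θ (suc c′) N) (Lacunary-2θ (suc d′) N)))))))
    where
    N = cutoff m
    θc = θ (𝕢 ^ suc c′) u N
    θd = θ (𝕢 ^ suc d′) u N

-- Reading the rank counts off the coefficients.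

+5-%ℕ : ∀ i → (i ℤ.+ + 5) %ℕ 5 ≡ i %ℕ 5
+5-%ℕ (+ n)    = [m+kn]%n≡m%n n 1 5
+5-%ℕ -[1+ 0 ] = ≡.refl
+5-%ℕ -[1+ 1 ] = ≡.refl
+5-%ℕ -[1+ 2 ] = ≡.refl
+5-%ℕ -[1+ 3 ] = ≡.refl
+5-%ℕ -[1+ 4 ] = ≡.refl
+5-%ℕ -[1+ suc (suc (suc (suc (suc n)))) ] = ≡.refl

+5*-%ℕ : ∀ t i → (i ℤ.+ + (5 ℕ.* t)) %ℕ 5 ≡ i %ℕ 5
+5*-%ℕ zero    i = ≡.cong (_%ℕ 5) (ℤ.+-identityʳ i)
+5*-%ℕ (suc t) i = ≡.trans (≡.cong (_%ℕ 5) regroup) (≡.trans (+5-%ℕ (i ℤ.+ + (5 ℕ.* t))) (+5*-%ℕ t i))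
  where
  regroup : i ℤ.+ + (5 ℕ.* suc t) ≡ i ℤ.+ + (5 ℕ.* t) ℤ.+ + 5
  regroup = ≡.trans (≡.cong (λ k → i ℤ.+ + k) (≡.trans (ℕ.*-suc 5 t) (ℕ.+-comm 5 (5 ℕ.* t))))
    (≡.sym (ℤ.+-assoc i (+ (5 ℕ.* t)) (+ 5)))

-- The rank modulo 5, with −1 replaced by 4.
rankShift : Quad → ℕ
rankShift (r , b , y , o) = (length r ℕ.+ length b ℕ.* 4) ℕ.+ (length y ℕ.+ length o ℕ.* 4)

-- Adding 5 times the number of parts of `b` and `o` turns each -1 into 4 and makes the rank a
-- natural number.
rank4-%ℕ : ∀ x → rank4 x %ℕ 5 ≡ rankShift x % 5
rank4-%ℕ x@(r , b , y , o) = ≡.trans (≡.sym (+5*-%ℕ (length b ℕ.+ length o) (rank4 x))) (≡.cong (_%ℕ 5) shifted)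
  where
  lemma : ∀ a b c d → ((a ℤ.- b) ℤ.+ (c ℤ.- d)) ℤ.+ (+ 5) ℤ.* (b ℤ.+ d) ≡ (a ℤ.+ b ℤ.* + 4) ℤ.+ (c ℤ.+ d ℤ.* + 4)
  lemma = ℤSolver.solve-∀
  shifted : rank4 x ℤ.+ + (5 ℕ.* (length b ℕ.+ length o)) ≡ + rankShift x
  shifted = ≡.trans (≡.cong (λ i → rank4 x ℤ.+ i) (ℤ.pos-* 5 (length b ℕ.+ length o)))
    (≡.trans (lemma (+ length r) (+ length b) (+ length y) (+ length o))
    (≡.cong₂ (λ i j → (+ length r ℤ.+ i) ℤ.+ (+ length y ℤ.+ j)) (≡.sym (ℤ.pos-* (length b) 4)) (≡.sym (ℤ.pos-* (length o) 4))))

ρ^ : ℕ → Fin 5 → Fin 5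
ρ^ zero    r = r
ρ^ (suc k) r = ρ^ k (ρ r)

ρ^-+ : ∀ k l r → ρ^ l (ρ^ k r) ≡ ρ^ (k ℕ.+ l) r
ρ^-+ zero    l r = ≡.refl
ρ^-+ (suc k) l r = ρ^-+ k l (ρ r)

indicator : Bool → ℤ
indicator b = if b then + 1 else + 0

δ₅ : Fin 5 → ℤ
δ₅ 0F = + 1
δ₅ _  = + 0

-- Five base cases and period 5. The reduced form `toℕ r % 5` is the one in which `N[_,_]` tests its
-- residue.
δ₅-ρ^ : ∀ k r → δ₅ (ρ^ k r) ≡ indicator (does (k % 5 ℕ.≟ toℕ r % 5))
δ₅-ρ^ 0 = λ { 0F → ≡.refl ; 1F → ≡.refl ; 2F → ≡.refl ; 3F → ≡.refl ; 4F → ≡.refl }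
δ₅-ρ^ 1 = λ { 0F → ≡.refl ; 1F → ≡.refl ; 2F → ≡.refl ; 3F → ≡.refl ; 4F → ≡.refl }
δ₅-ρ^ 2 = λ { 0F → ≡.refl ; 1F → ≡.refl ; 2F → ≡.refl ; 3F → ≡.refl ; 4F → ≡.refl }
δ₅-ρ^ 3 = λ { 0F → ≡.refl ; 1F → ≡.refl ; 2F → ≡.refl ; 3F → ≡.refl ; 4F → ≡.refl }
δ₅-ρ^ 4 = λ { 0F → ≡.refl ; 1F → ≡.refl ; 2F → ≡.refl ; 3F → ≡.refl ; 4F → ≡.refl }
δ₅-ρ^ (suc (suc (suc (suc (suc k))))) r =
  ≡.trans (≡.cong (λ s → δ₅ (ρ^ k s)) (ρ⁵ r)) (δ₅-ρ^ k r)

-- The action of the monomial `z ^ k q ^ s`. The exponent `k` stays unreduced, so that exponents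
-- simply add under `⊗`.
record Shift (p : Poly) (k s : ℕ) : Set where
  field
    above : ∀ x n r → ⟦ p ⟧ x (s ℕ.+ n) r ≡ x n (ρ^ k r)
    below : ∀ x n r → n ℕ.< s → ⟦ p ⟧ x n r ≡ + 0
open Shift

Shift-𝟙 : Shift 𝟙 0 0
Shift-𝟙 = record { above = λ _ _ _ → ≡.refl ; below = λ _ _ _ () }

Shift-𝕫 : Shift 𝕫 1 0
Shift-𝕫 = record { above = λ _ _ _ → ≡.refl ; below = λ _ _ _ () }

Shift-𝕢 : Shift 𝕢 0 1
Shift-𝕢 = record { above = λ _ _ _ → ≡.refl ; below = λ { _ zero _ _ → ≡.refl ; _ (suc _) _ (s≤s ()) } }

Shift-⊗ : ∀ {p p′ k k′ s s′} → Shift p k s → Shift p′ k′ s′ → Shift (p ⊗ p′) (k ℕ.+ k′) (s ℕ.+ s′)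
Shift-⊗ {p} {p′} {k} {k′} {s} {s′} σ σ′ = record { above = up ; below = down }
  where
  open ≡.≡-Reasoning
  up : ∀ x n r → ⟦ p ⟧ (⟦ p′ ⟧ x) (s ℕ.+ s′ ℕ.+ n) r ≡ x n (ρ^ (k ℕ.+ k′) r)
  up x n r = begin
    ⟦ p ⟧ (⟦ p′ ⟧ x) (s ℕ.+ s′ ℕ.+ n) r      ≡⟨ ≡.cong (λ n → ⟦ p ⟧ (⟦ p′ ⟧ x) n r) (ℕ.+-assoc s s′ n) ⟩
    ⟦ p ⟧ (⟦ p′ ⟧ x) (s ℕ.+ (s′ ℕ.+ n)) r    ≡⟨ above σ (⟦ p′ ⟧ x) (s′ ℕ.+ n) r ⟩
    ⟦ p′ ⟧ x (s′ ℕ.+ n) (ρ^ k r)             ≡⟨ above σ′ x n (ρ^ k r) ⟩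
    x n (ρ^ k′ (ρ^ k r))                     ≡⟨ ≡.cong (x n) (ρ^-+ k k′ r) ⟩
    x n (ρ^ (k ℕ.+ k′) r)                    ∎
  down : ∀ x n r → n ℕ.< s ℕ.+ s′ → ⟦ p ⟧ (⟦ p′ ⟧ x) n r ≡ + 0
  down x n r n< with s ℕ.≤? n
  ... | no  s≰n = below σ (⟦ p′ ⟧ x) n r (ℕ.≰⇒> s≰n)
  ... | yes s≤n with l , ≡.refl ← ℕ.m≤n⇒∃[o]m+o≡n s≤n =
    ≡.trans (above σ (⟦ p′ ⟧ x) l r) (below σ′ x l (ρ^ k r) (ℕ.+-cancelˡ-< s l s′ n<))

module Coefficients (m : ℕ) where
  open Truncated m
  open Exp (CommutativeRing.commutativeSemiring commutativeRing) using (_^_)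
  open PartitionSeries commutativeRing using (∑; monomial)
  open RankSeries commutativeRing using (quadWeight)

  -- By definition equal to `z⁻¹` of `FifthRoot` at `𝕫`, so that `Balanced-quads` applies to the
  -- same series.
  𝕫⁻¹ : Poly
  𝕫⁻¹ = 𝕫 ⊗ (𝕫 ⊗ (𝕫 ⊗ 𝕫))

  Shift-^ : ∀ {p k s} → Shift p k s → ∀ n → Shift (p ^ n) (n ℕ.* k) (n ℕ.* s)
  Shift-^ σ zero    = Shift-𝟙
  Shift-^ σ (suc n) = Shift-⊗ σ (Shift-^ σ n)

  Shift-monomial : ∀ {p k} → Shift p k 0 → ∀ xs → Shift (monomial p 𝕢 xs) (length xs ℕ.* k) (sum xs)
  Shift-monomial {p} {k} σ xs =
    ≡.subst₂ (Shift (monomial p 𝕢 xs)) rotation degree (Shift-⊗ (Shift-^ σ (length xs)) (Shift-^ Shift-𝕢 (sum xs)))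
    where
    rotation : length xs ℕ.* k ℕ.+ sum xs ℕ.* 0 ≡ length xs ℕ.* k
    rotation = ≡.trans (≡.cong (length xs ℕ.* k ℕ.+_) (ℕ.*-zeroʳ (sum xs))) (ℕ.+-identityʳ _)
    degree : length xs ℕ.* 0 ℕ.+ sum xs ℕ.* 1 ≡ sum xs
    degree = ≡.cong₂ ℕ._+_ (ℕ.*-zeroʳ (length xs)) (ℕ.*-identityʳ (sum xs))

  Shift-quadWeight : ∀ x → Shift (quadWeight 𝕫 𝕫⁻¹ 𝕢 x) (rankShift x) (size x)
  Shift-quadWeight x@(r , b , y , o) = ≡.subst₂ (Shift (quadWeight 𝕫 𝕫⁻¹ 𝕢 x)) rotation degree
    (Shift-⊗ (Shift-⊗ (Shift-monomial Shift-𝕫 r) (Shift-monomial Shift-𝕫⁻¹ b))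
             (Shift-⊗ (Shift-monomial Shift-𝕫 y) (Shift-monomial Shift-𝕫⁻¹ o)))
    where
    Shift-𝕫⁻¹ : Shift 𝕫⁻¹ 4 0
    Shift-𝕫⁻¹ = Shift-⊗ Shift-𝕫 (Shift-⊗ Shift-𝕫 (Shift-⊗ Shift-𝕫 Shift-𝕫))
    rotation : (length r ℕ.* 1 ℕ.+ length b ℕ.* 4) ℕ.+ (length y ℕ.* 1 ℕ.+ length o ℕ.* 4) ≡ rankShift x
    rotation = ≡.cong₂ (λ i j → (i ℕ.+ length b ℕ.* 4) ℕ.+ (j ℕ.+ length o ℕ.* 4)) (ℕ.*-identityʳ (length r)) (ℕ.*-identityʳ (length y))
    degree : (sum r ℕ.+ sum b) ℕ.+ (sum y ℕ.+ sum o) ≡ size x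
    degree = ≡.sym (ℕ.+-assoc (sum r ℕ.+ sum b) (sum y) (sum o))

  δ-zero : ∀ r → δ 0 r ≡ δ₅ r
  δ-zero 0F = ≡.refl
  δ-zero 1F = ≡.refl
  δ-zero 2F = ≡.refl
  δ-zero 3F = ≡.refl
  δ-zero 4F = ≡.refl

  Shift-coefficient : ∀ {p k s} → Shift p k s → ∀ n r →
    ⟦ p ⟧ δ n r ≡ (if does (s ℕ.≟ n) then indicator (does (k % 5 ℕ.≟ toℕ r % 5)) else + 0)
  Shift-coefficient {p} {k} {s} σ n r with ℕ.<-cmp n s
  ... | tri< n<s n≢s _ rewrite dec-false (s ℕ.≟ n) (λ e → n≢s (≡.sym e)) = below σ δ n r n<s
  ... | tri≈ _ ≡.refl _ rewrite dec-true (s ℕ.≟ s) ≡.refl = ≡.trans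
    (≡.trans (≡.cong (λ n → ⟦ p ⟧ δ n r) (≡.sym (ℕ.+-identityʳ s))) (above σ δ 0 r))
    (≡.trans (δ-zero (ρ^ k r)) (δ₅-ρ^ k r))
  ... | tri> _ n≢s s<n rewrite dec-false (s ℕ.≟ n) (λ e → n≢s (≡.sym e))
    with l , ≡.refl ← ℕ.m≤n⇒∃[o]m+o≡n s<n =
      ≡.trans (≡.cong (λ n → ⟦ p ⟧ δ n r) (≡.sym (ℕ.+-suc s l))) (above σ δ (suc l) r)

  -- A sum of indicators counts; the filters are nested as in `N[_,_]`, size inside and rank
  -- outside.
  ∑-coefficient : ∀ {X : Set} {P R : Pred X 0ℓ} (P? : Decidable P) (R? : Decidable R) (w : X → Poly) n r →
    (∀ x → ⟦ w x ⟧ δ n r ≡ (if does (P? x) then indicator (does (R? x)) else + 0)) →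
    ∀ xs → ⟦ ∑ xs w ⟧ δ n r ≡ + length (filter R? (filter P? xs))
  ∑-coefficient P? R? w n r hw []       = ≡.refl
  ∑-coefficient P? R? w n r hw (x ∷ xs) with does (P? x) | hw x
  ... | false | e = ≡.trans (≡.cong₂ ℤ._+_ e (∑-coefficient P? R? w n r hw xs)) (ℤ.+-identityˡ _)
  ... | true  | e with does (R? x)
  ...   | false = ≡.trans (≡.cong₂ ℤ._+_ e (∑-coefficient P? R? w n r hw xs)) (ℤ.+-identityˡ _)
  ...   | true  = ≡.cong₂ ℤ._+_ e (∑-coefficient P? R? w n r hw xs)

  N-coefficient : ∀ c d r → ⟦ ∑ (quads c d m) (quadWeight 𝕫 𝕫⁻¹ 𝕢) ⟧ δ m r ≡ + N[ c , d ] (toℕ r) m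
  N-coefficient c d r = ∑-coefficient (λ x → size x ℕ.≟ m) (λ x → (rank4 x %ℕ 5) ℕ.≟ (toℕ r % 5)) (quadWeight 𝕫 𝕫⁻¹ 𝕢) m r coefficient (quads c d m)
    where
    coefficient : ∀ x → ⟦ quadWeight 𝕫 𝕫⁻¹ 𝕢 x ⟧ δ m r ≡
      (if does (size x ℕ.≟ m) then indicator (does (rank4 x %ℕ 5 ℕ.≟ toℕ r % 5)) else + 0)
    coefficient x = ≡.trans (Shift-coefficient (Shift-quadWeight x) m r)
      (≡.cong (λ k → if does (size x ℕ.≟ m) then indicator (does (k ℕ.≟ toℕ r % 5)) else + 0) (≡.sym (rank4-%ℕ x)))

  -- Balance at the exponent `m` itself says that the entries at `r` and `ρ r` agree, and these
  -- entries are the counts.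
  N-equidistributed : ∀ c′ d′ → let c = suc c′; d = suc d′ in
    (∀ e f → e % 5 ℕ.≤ 1 → f % 5 ℕ.≤ 1 → (c ℕ.* e ℕ.+ d ℕ.* f) % 5 ≢ m % 5) →
    ∀ r → N[ c , d ] (toℕ r) m ≡ N[ c , d ] (toℕ (ρ r)) m
  N-equidistributed c′ d′ avoid r = ℤ.+-injective (ℤ.i-j≡0⇒i≡j _ _ (≡.trans
    (≡.cong₂ ℤ._-_ (≡.sym (N-coefficient (suc c′) (suc d′) r)) (≡.sym (N-coefficient (suc c′) (suc d′) (ρ r))))
    (flat (Balanced-quads c′ d′ avoid) m r ℕ.≤-refl ≡.refl)))

-- Residue classes, the table of residues, and the conclusion.

-- Tests against `k % 5` so that `N[_,_]` is an instance by definition.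
classSize : {X : Set} → (X → ℕ) → List X → ℕ → ℕ
classSize f xs k = length (filter (λ x → f x ℕ.≟ k % 5) xs)

length-classes : ∀ {X : Set} (f : X → ℕ) → (∀ x → f x ℕ.< 5) → ∀ xs → let n = classSize f xs in
  length xs ≡ n 0 ℕ.+ (n 1 ℕ.+ (n 2 ℕ.+ (n 3 ℕ.+ n 4)))
length-classes f f<5 []       = ≡.refl
length-classes f f<5 (x ∷ xs) =
  ≡.trans (≡.cong suc (length-classes f f<5 xs)) increment
  where
  open +-*-Solver
  n = classSize f xs
  increment : suc (n 0 ℕ.+ (n 1 ℕ.+ (n 2 ℕ.+ (n 3 ℕ.+ n 4)))) ≡
    classSize f (x ∷ xs) 0 ℕ.+ (classSize f (x ∷ xs) 1 ℕ.+ (classSize f (x ∷ xs) 2 ℕ.+ (classSize f (x ∷ xs) 3 ℕ.+ classSize f (x ∷ xs) 4)))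
  increment with f x | f<5 x
  ... | 0 | _ = ≡.refl
  ... | 1 | _ = solve 5 (λ a b c d e → con 1 :+ (a :+ (b :+ (c :+ (d :+ e)))) := a :+ ((con 1 :+ b) :+ (c :+ (d :+ e)))) ≡.refl (n 0) (n 1) (n 2) (n 3) (n 4)
  ... | 2 | _ = solve 5 (λ a b c d e → con 1 :+ (a :+ (b :+ (c :+ (d :+ e)))) := a :+ (b :+ ((con 1 :+ c) :+ (d :+ e)))) ≡.refl (n 0) (n 1) (n 2) (n 3) (n 4)
  ... | 3 | _ = solve 5 (λ a b c d e → con 1 :+ (a :+ (b :+ (c :+ (d :+ e)))) := a :+ (b :+ (c :+ ((con 1 :+ d) :+ e)))) ≡.refl (n 0) (n 1) (n 2) (n 3) (n 4)
  ... | 4 | _ = solve 5 (λ a b c d e → con 1 :+ (a :+ (b :+ (c :+ (d :+ e)))) := a :+ (b :+ (c :+ (d :+ (con 1 :+ e))))) ≡.refl (n 0) (n 1) (n 2) (n 3) (n 4)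
  ... | suc (suc (suc (suc (suc _)))) | s≤s (s≤s (s≤s (s≤s (s≤s ()))))

Avoids : ℕ → ℕ → ℕ → Set
Avoids i j a = ∀ (e f : Fin 2) → (i ℕ.* toℕ e ℕ.+ j ℕ.* toℕ f) % 5 ≢ a % 5

-- A finite check by evaluation over all 25 ordered pairs of residues. The exponents 0 and 1 produce
-- the values 0, `i`, `j` and `i + j`.
A-avoids : ∀ (i j : Fin 5) → All (Avoids (toℕ i) (toℕ j)) (A (toℕ i) (toℕ j))
A-avoids = from-yes (Fin.all? {5} λ i → Fin.all? {5} λ j → all? (λ a → Fin.all? {2} λ e → Fin.all? {2} λ f →
  ¬? ((toℕ i ℕ.* toℕ e ℕ.+ toℕ j ℕ.* toℕ f) % 5 ℕ.≟ a % 5)) (A (toℕ i) (toℕ j)))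

open import Data.Nat using (_+_; _*_)

A-avoids-exponents : ∀ c d {a} → a ∈ A (c % 5) (d % 5) →
  ∀ e f → e % 5 ≤ 1 → f % 5 ≤ 1 → (c * e + d * f) % 5 ≢ a % 5
A-avoids-exponents c d {a} a∈A e f e≤1 f≤1 eq = avoided (fromℕ< (s≤s e≤1)) (fromℕ< (s≤s f≤1)) (begin
  (c % 5 * toℕ (fromℕ< (s≤s e≤1)) + d % 5 * toℕ (fromℕ< (s≤s f≤1))) % 5
    ≡⟨ ≡.cong₂ (λ x y → (c % 5 * x + d % 5 * y) % 5) (Fin.toℕ-fromℕ< (s≤s e≤1)) (Fin.toℕ-fromℕ< (s≤s f≤1)) ⟩
  (c % 5 * (e % 5) + d % 5 * (f % 5)) % 5
    ≡⟨ %-distribˡ-+ (c % 5 * (e % 5)) (d % 5 * (f % 5)) 5 ⟩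
  ((c % 5 * (e % 5)) % 5 + (d % 5 * (f % 5)) % 5) % 5
    ≡⟨ ≡.cong₂ (λ x y → (x + y) % 5) (%-distribˡ-* c e 5) (%-distribˡ-* d f 5) ⟨
  (c * e % 5 + d * f % 5) % 5
    ≡⟨ %-distribˡ-+ (c * e) (d * f) 5 ⟨
  (c * e + d * f) % 5
    ≡⟨ eq ⟩
  a % 5 ∎)
  where
  open ≡.≡-Reasoning
  avoided : Avoids (c % 5) (d % 5) a
  avoided = All.lookup
    (≡.subst₂ (λ i j → All (Avoids i j) (A i j)) (Fin.toℕ-fromℕ< (m%n<n c 5)) (Fin.toℕ-fromℕ< (m%n<n d 5))
      (A-avoids (fromℕ< (m%n<n c 5)) (fromℕ< (m%n<n d 5)))) a∈A

theorem3p3 : (c d i j a : ℕ) → 1 ≤ c → c ≤ d → i ≤ 4 → j ≤ 4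
    → c % 5 ≡ i → d % 5 ≡ j → a ∈ A i j
    → (n k : ℕ) → k ≤ 4
    → (5 * N[ c , d ] k (5 * n + a) ≡ p[c²d²] c d (5 * n + a))
    × (p[c²d²] c d (5 * n + a) % 5 ≡ 0)
theorem3p3 c@(suc c′) d@(suc d′) _ _ a _ _ _ _ ≡.refl ≡.refl a∈A n k k≤4 =
  5N≡p , ≡.trans (≡.cong (_% 5) (≡.sym 5N≡p)) (≡.trans (≡.cong (_% 5) (ℕ.*-comm 5 (N k))) (m*n%n≡0 (N k) 5))
  where
  m = 5 * n + a
  N : ℕ → ℕ
  N k = N[ c , d ] k m
  m%5 : m % 5 ≡ a % 5
  m%5 = ≡.trans (≡.cong (_% 5) (≡.trans (ℕ.+-comm (5 * n) a) (≡.cong (λ t → a + t) (ℕ.*-comm 5 n)))) ([m+kn]%n≡m%n a n 5)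
  step : ∀ r → N (toℕ r) ≡ N (toℕ (ρ r))
  step = Coefficients.N-equidistributed m c′ d′ (λ e f e≤1 f≤1 eq → A-avoids-exponents c d a∈A e f e≤1 f≤1 (≡.trans eq m%5))
  -- `ρ` lowers the residue by one, so at most four steps lead from any class to class 0.
  N₁ : N 1 ≡ N 0
  N₁ = step 1F
  N₂ : N 2 ≡ N 0
  N₂ = ≡.trans (step 2F) N₁
  N₃ : N 3 ≡ N 0
  N₃ = ≡.trans (step 3F) N₂
  N₄ : N 4 ≡ N 0
  N₄ = ≡.trans (step 4F) N₃
  Nₖ : ∀ {k} → k ≤ 4 → N k ≡ N 0
  Nₖ z≤n                         = ≡.refl
  Nₖ (s≤s z≤n)                   = N₁
  Nₖ (s≤s (s≤s z≤n))             = N₂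
  Nₖ (s≤s (s≤s (s≤s z≤n)))       = N₃
  Nₖ (s≤s (s≤s (s≤s (s≤s z≤n)))) = N₄
  5N≡p : 5 * N k ≡ p[c²d²] c d m
  5N≡p = begin
    5 * N k                            ≡⟨ ≡.cong (5 *_) (Nₖ k≤4) ⟩
    5 * N 0                            ≡⟨ ≡.cong (λ x → N 0 + (N 0 + (N 0 + (N 0 + x)))) (ℕ.+-identityʳ (N 0)) ⟩
    N 0 + (N 0 + (N 0 + (N 0 + N 0)))  ≡⟨ ≡.cong₂ (λ x y → N 0 + (x + y)) N₁ (≡.cong₂ _+_ N₂ (≡.cong₂ _+_ N₃ N₄)) ⟨
    N 0 + (N 1 + (N 2 + (N 3 + N 4)))  ≡⟨ length-classes (λ x → rank4 x %ℕ 5) (λ x → ℤ.n%ℕd<d (rank4 x) 5) (colored4 c d m) ⟨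
    p[c²d²] c d m                      ∎
    where open ≡.≡-Reasoning
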